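{- Let $H\in\{\text{house},\text{hammer},\text{diamond}\}$, let $\mathcal{C}$ be the class of $(\text{bull},H)$-free graphs, let $\mathcal{G}$ be a hereditary class of graphs, and let $\mathcal{H}$ be the class of triangle-free graphs. Then every graph in $\mathcal{G}\cap\mathcal{C}$ is perfectly divisible if and only if every graph in $\mathcal{G}\cap\mathcal{H}$ is perfectly divisible.
   Context: Graphs are finite and simple. A bull is a triangle with two disjoint pendant edges. A house is the complement of $P_5$. A hammer is obtained by identifying an end vertex of a $P_3$ with a vertex of a triangle. A diamond is $K_4$ minus an edge. A class is hereditary if closed under isomorphism and induced subgraphs. A graph is perfect if $\chi(H)=\omega(H)$ for all induced subgraphs $H$. $G$ is perfectly divisible if for every induced subgraph $H$ of $G$, $V(H)$ can be partitioned into $A,B$ with $H[A]$ perfect and $\omega(H[B])<\omega(H)$. -}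

module Defs where

open import Data.Nat using (ℕ; _≤_; _<_)
open import Data.Fin using (Fin; zero; suc; _≟_)
open import Data.Bool using (Bool; true; false; _∧_; _∨_; not; T)
open import Data.Bool.Properties using (∨-comm)
open import Data.List using (List; []; _∷_)
open import Data.Bool.ListAction using (any)
open import Data.Product using (Σ; ∃; _×_; _,_)
open import Relation.Nullary using (¬_)
open import Relation.Nullary.Decidable using (⌊_⌋)
open import Relation.Binary.PropositionalEquality using (_≡_; _≢_; refl)
open import Function.Definitions using (Injective)

record Graph : Set where
  field
    n          : ℕ
    adj        : Fin n → Fin n → Bool
    adj-sym    : ∀ i j → adj i j ≡ adj j i
    adj-irrefl : ∀ i → adj i i ≡ false
open Graph public

Embedding : Graph → Graph → Set
Embedding K G =
  Σ (Fin (n K) → Fin (n G)) λ f →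
    Injective _≡_ _≡_ f × (∀ i j → adj K i j ≡ adj G (f i) (f j))

Free : Graph → Graph → Set
Free G H = ¬ Embedding H G

-- A hereditary class (closed under isomorphism and induced subgraphs;
-- both are captured by closure under induced embeddings).
Hereditary : (Graph → Set) → Set
Hereditary P = ∀ {K G} → Embedding K G → P G → P K

-- Vertex subsets (an induced subgraph G[S] is given by its vertex set S)

VSet : Graph → Set
VSet G = Fin (n G) → Bool

_⊆_ : {G : Graph} → VSet G → VSet G → Set
_⊆_ {G} A S = ∀ (v : Fin (n G)) → T (A v) → T (S v)

_∖_ : {G : Graph} → VSet G → VSet G → VSet G
(S ∖ A) v = S v ∧ not (A v)

NonemptyV : (G : Graph) → VSet G → Set
NonemptyV G S = Σ (Fin (n G)) λ v → T (S v)

HasClique : (G : Graph) → VSet G → ℕ → Set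
HasClique G S k =
  Σ (Fin k → Fin (n G)) λ f →
    Injective _≡_ _≡_ f × (∀ i → T (S (f i))) ×
    (∀ i j → i ≢ j → adj G (f i) (f j) ≡ true)

CliqueNumber : (G : Graph) → VSet G → ℕ → Set
CliqueNumber G S k = HasClique G S k × (∀ j → HasClique G S j → j ≤ k)

Colourable : (G : Graph) → VSet G → ℕ → Set
Colourable G S k =
  Σ ((v : Fin (n G)) → T (S v) → Fin k) λ c →
    ∀ u v (su : T (S u)) (sv : T (S v)) → adj G u v ≡ true → c u su ≢ c v sv

ChromaticNumber : (G : Graph) → VSet G → ℕ → Set
ChromaticNumber G S k = Colourable G S k × (∀ j → Colourable G S j → k ≤ j)

PerfectOn : (G : Graph) → VSet G → Set
PerfectOn G A =
  ∀ (X : VSet G) → _⊆_ {G} X A → ∃ λ k → CliqueNumber G X k × ChromaticNumber G X k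

Perfect : Graph → Set
Perfect G = PerfectOn G (λ _ → true)

PerfectlyDivisible : Graph → Set
PerfectlyDivisible G =
  ∀ (S : VSet G) → NonemptyV G S →
    Σ (VSet G) λ A → (_⊆_ {G} A S) × PerfectOn G A ×
      (∃ λ a → ∃ λ b → CliqueNumber G (_∖_ {G} S A) a × CliqueNumber G S b × a < b)

memE : ∀ {m} → List (Fin m × Fin m) → Fin m → Fin m → Bool
memE es i j = any (λ { (a , b) → ⌊ a ≟ i ⌋ ∧ ⌊ b ≟ j ⌋ }) es

edgeAdj : ∀ {m} → List (Fin m × Fin m) → Fin m → Fin m → Bool
edgeAdj es i j = memE es i j ∨ memE es j i

edgeAdj-sym : ∀ {m} (es : List (Fin m × Fin m)) i j → edgeAdj es i j ≡ edgeAdj es j i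
edgeAdj-sym es i j = ∨-comm (memE es i j) (memE es j i)

private
  v0 v1 v2 v3 v4 : ∀ {m} → Fin (5 Data.Nat.+ m)
  v0 = zero
  v1 = suc zero
  v2 = suc (suc zero)
  v3 = suc (suc (suc zero))
  v4 = suc (suc (suc (suc zero)))

triangleE : List (Fin 3 × Fin 3)
triangleE = (zero , suc zero) ∷ (suc zero , suc (suc zero)) ∷ (zero , suc (suc zero)) ∷ []

triangle : Graph
triangle = record { n = 3 ; adj = edgeAdj triangleE ; adj-sym = edgeAdj-sym triangleE
                  ; adj-irrefl = λ { zero → refl ; (suc zero) → refl ; (suc (suc zero)) → refl } }

bullE : List (Fin 5 × Fin 5)
bullE = (v0 , v1) ∷ (v1 , v2) ∷ (v0 , v2) ∷ (v0 , v3) ∷ (v1 , v4) ∷ []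

bull : Graph
bull = record { n = 5 ; adj = edgeAdj bullE ; adj-sym = edgeAdj-sym bullE
              ; adj-irrefl = λ { zero → refl ; (suc zero) → refl ; (suc (suc zero)) → refl
                               ; (suc (suc (suc zero))) → refl ; (suc (suc (suc (suc zero)))) → refl } }

-- house: complement of the path 0-1-2-3-4
houseE : List (Fin 5 × Fin 5)
houseE = (v0 , v2) ∷ (v0 , v3) ∷ (v0 , v4) ∷ (v1 , v3) ∷ (v1 , v4) ∷ (v2 , v4) ∷ []

house : Graph
house = record { n = 5 ; adj = edgeAdj houseE ; adj-sym = edgeAdj-sym houseE
               ; adj-irrefl = λ { zero → refl ; (suc zero) → refl ; (suc (suc zero)) → refl
                                ; (suc (suc (suc zero))) → refl ; (suc (suc (suc (suc zero)))) → refl } }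

hammerE : List (Fin 5 × Fin 5)
hammerE = (v0 , v1) ∷ (v1 , v2) ∷ (v0 , v2) ∷ (v0 , v3) ∷ (v3 , v4) ∷ []

hammer : Graph
hammer = record { n = 5 ; adj = edgeAdj hammerE ; adj-sym = edgeAdj-sym hammerE
                ; adj-irrefl = λ { zero → refl ; (suc zero) → refl ; (suc (suc zero)) → refl
                                 ; (suc (suc (suc zero))) → refl ; (suc (suc (suc (suc zero)))) → refl } }

diamondE : List (Fin 4 × Fin 4)
diamondE = (zero , suc zero) ∷ (zero , suc (suc zero)) ∷ (zero , suc (suc (suc zero)))
         ∷ (suc zero , suc (suc zero)) ∷ (suc zero , suc (suc (suc zero))) ∷ []

diamond : Graph
diamond = record { n = 4 ; adj = edgeAdj diamondE ; adj-sym = edgeAdj-sym diamondE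
                 ; adj-irrefl = λ { zero → refl ; (suc zero) → refl ; (suc (suc zero)) → refl
                                  ; (suc (suc (suc zero))) → refl } }

data Choice : Set where
  house-c hammer-c diamond-c : Choice

forbidden : Choice → Graph
forbidden house-c   = house
forbidden hammer-c  = hammer
forbidden diamond-c = diamond

module Submission where

-- Triangle-free graphs are perfectly divisible iff they are 3-colourable, and
-- each of the three graphs H (and the bull) contains a triangle, so only the
-- implication from 𝒢 ∩ ℋ to 𝒢 ∩ 𝒞 has content.  There one proves a weighted
-- statement: for all positive vertex weights some perfect set meets every clique
-- of maximum weight.  In this form a homogeneous set X can be contracted to one
-- vertex of weight ω(X), because a multicolouring notion of perfection is
-- preserved by substitution.  A simplicial vertex can be deleted, and a vertex v
-- whose non-neighbours form a clique or a stable set gives the perfect set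
-- consisting of v and its non-neighbours.
--
-- It remains to see that a prime (bull, H)-free graph with a triangle has such a
-- vertex.  If it is also house-free, every neighbourhood is connected.  For
-- H = house, a C₄ yields a maximal pair of co-connected sets complete to each
-- other, which contradicts this; in the C₄-free case a vertex with minimal
-- closed neighbourhood is simplicial.  For H = hammer, a maximal pair of
-- anticomplete connected sets rules out 2K₂, and the C₄-free case applies to the
-- complement.  For H = diamond, a maximal clique K in which no vertex is
-- simplicial has exactly one further neighbour at each vertex, and the vertices
-- outside K form a clique.

open import Defs renaming (n to order; adj to edge) hiding (_⊆_; _∖_)

open import Axiom.UniquenessOfIdentityProofs using (module Decidable⇒UIP)
open import Data.Bool as Bool using (Bool; true; false; _∧_; _∨_; not; if_then_else_; T)
open import Data.Bool.Properties using (T-≡; ¬-not)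
open import Data.Empty using (⊥; ⊥-elim)
open import Data.Fin as Fin using (Fin; zero; suc)
import Data.Fin.Properties as Finₚ
open import Data.Fin.Subset.Properties using (anySubset?)
open import Data.List using (List; []; _∷_; map; filter; _++_; allFin; length; lookup; tabulate)
open import Data.List.Membership.Propositional using (_∈_; find; lose)
open import Data.List.Membership.Propositional.Properties using (∈-filter⁺; ∈-allFin; ∈-lookup)
open import Data.List.Properties using (map-++; length-tabulate)
open import Data.List.Relation.Unary.All as All using (All; []; _∷_)
import Data.List.Relation.Unary.All.Properties as Allₚ
open import Data.List.Relation.Unary.AllPairs using (AllPairs; []; _∷_)
import Data.List.Relation.Unary.AllPairs.Properties as AllPairsₚ
open import Data.List.Relation.Unary.Any as Any using (here; there)
open import Data.List.Relation.Unary.Any.Properties using (lookup-index)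
open import Data.List.Relation.Unary.Unique.Propositional using (Unique)
import Data.List.Relation.Unary.Unique.Propositional.Properties as Uniqueₚ
open import Data.Nat using (ℕ; zero; suc; _+_; _*_; _∸_; _≤_; _<_; z≤n; s≤s; _≤?_)
open import Data.Nat.Induction using (<-wellFounded)
open import Data.Nat.ListAction using (sum)
open import Data.Nat.ListAction.Properties using (sum-++)
import Data.Nat.Properties as ℕₚ
open import Algebra.Properties.CommutativeSemigroup ℕₚ.+-commutativeSemigroup using (x∙yz≈y∙xz)
open import Data.Product using (Σ; ∃; _×_; _,_; proj₁; proj₂)
open import Data.Sum using (_⊎_; inj₁; inj₂; [_,_]′)
open import Data.Unit using (⊤; tt)
open import Data.Vec as Vec using ([]; _∷_)
import Data.Vec.Properties as Vecₚ
open import Function using (_∘_; id; case_of_)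
open import Function.Bundles using (Equivalence; _⇔_; mk⇔)
open import Function.Definitions using (Injective)
open import Induction.WellFounded using (Acc; acc)
open import Relation.Binary.Definitions using (DecidableEquality)
open import Relation.Binary.PropositionalEquality using (_≡_; _≢_; refl; sym; trans; cong; cong₂; subst; ≢-sym)
open import Relation.Nullary using (¬_; yes; no; Dec)
open import Relation.Nullary.Decidable using (⌊_⌋; map′; _×-dec_; _→-dec_; ¬?; from-yes)

-- Contracting a homogeneous set keeps one of its vertices, so the induction never leaves the vertex
-- subsets of one graph; only clique sizes change, and the weights record that change. They stay
-- positive so that adding a vertex to a clique makes it strictly heavier: a clique that avoids the
-- perfect set but can be extended by some vertex is then not of maximum weight.
--
-- Primality mostly enters in one way. Certain vertices are singled out (`Central`, `Full`), and
-- each of them is shown to be complete to the component of a base vertex among the remaining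
-- vertices. A vertex outside this component with a neighbour in it must be singled out, so the
-- component is homogeneous, which is absurd once a single such vertex exists.
--
-- The structure theory only has to refute that all the finite searches of `divisible-acc` fail. Its
-- conclusions are therefore `⊥` or double negations, and undecidable notions such as reachability
-- cause no harm.

true≢false : ∀ {b} → b ≡ true → b ≡ false → ⊥
true≢false refl ()

not-true : ∀ {b} → not b ≡ true → b ≡ false
not-true {false} _ = refl

not-false : ∀ {b} → not b ≡ false → b ≡ true
not-false {true} _ = refl

¬true⇒false : ∀ {b} → (b ≡ true → ⊥) → b ≡ false
¬true⇒false = ¬-not

¬false⇒true : ∀ {b} → (b ≡ false → ⊥) → b ≡ true
¬false⇒true = ¬-not

∨-elim : ∀ a {b} → a ∨ b ≡ true → a ≡ true ⊎ b ≡ true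
∨-elim true  _ = inj₁ refl
∨-elim false h = inj₂ h

∨-inˡ : ∀ {a b} → a ≡ true → a ∨ b ≡ true
∨-inˡ refl = refl

∨-inʳ : ∀ a {b} → b ≡ true → a ∨ b ≡ true
∨-inʳ true  _ = refl
∨-inʳ false h = h

∧-elim : ∀ a {b} → a ∧ b ≡ true → a ≡ true × b ≡ true
∧-elim true h = refl , h

∧-in : ∀ {a b} → a ≡ true → b ≡ true → a ∧ b ≡ true
∧-in refl h = h

-- Counting vertices

count : {V : Set} → (V → Bool) → List V → ℕ
count f []       = 0
count f (v ∷ vs) with f v
... | true  = suc (count f vs)
... | false = count f vs

count-mono : {V : Set} {f g : V → Bool} → (∀ v → f v ≡ true → g v ≡ true) → ∀ vs → count f vs ≤ count g vs
count-mono imp [] = z≤n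
count-mono {f = f} {g} imp (v ∷ vs) with f v in fv | g v in gv
... | true  | true  = s≤s (count-mono imp vs)
... | true  | false = ⊥-elim (true≢false (imp v fv) gv)
... | false | true  = ℕₚ.m≤n⇒m≤1+n (count-mono imp vs)
... | false | false = count-mono imp vs

count-strict : {V : Set} {f g : V → Bool} → (∀ v → f v ≡ true → g v ≡ true) →
  ∀ {u} → g u ≡ true → f u ≡ false → ∀ {vs} → u ∈ vs → count f vs < count g vs
count-strict {f = f} {g} imp {u} gu fu {v ∷ vs} (here refl) with f u | g u
count-strict imp refl refl {v ∷ vs} (here refl) | false | true = s≤s (count-mono imp vs)
count-strict {f = f} {g} imp gu fu {v ∷ vs} (there u∈) with f v in fv | g v in gv
... | true  | true  = s≤s (count-strict imp gu fu u∈)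
... | true  | false = ⊥-elim (true≢false (imp v fv) gv)
... | false | true  = ℕₚ.m≤n⇒m≤1+n (count-strict imp gu fu u∈)
... | false | false = count-strict imp gu fu u∈

-- Paths, components and primality

-- All arguments about a fixed adjacency have conclusion ⊥, so undecided
-- propositions may be treated classically there.
module Adjacency {V : Set} (E : V → V → Bool) (E-sym : ∀ u v → E u v ≡ E v u) (E-irr : ∀ v → E v v ≡ false) where

  infix 4 _~_ _≁_

  _~_ _≁_ : V → V → Set
  u ~ v = E u v ≡ true
  u ≁ v = E u v ≡ false

  ~-sym : ∀ {u v} → u ~ v → v ~ u
  ~-sym {u} {v} p = trans (E-sym v u) p

  ≁-sym : ∀ {u v} → u ≁ v → v ≁ u
  ≁-sym {u} {v} p = trans (E-sym v u) p

  clash : ∀ {u v} → u ~ v → u ≁ v → ⊥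
  clash = true≢false

  ~⇒≢ : ∀ {u v} → u ~ v → u ≢ v
  ~⇒≢ {u} p refl = clash p (E-irr u)

  separated : ∀ {a b c} → a ~ c → b ≁ c → a ≢ b
  separated p q refl = clash p q

  adjacent? : ∀ u v → u ~ v ⊎ u ≁ v
  adjacent? u v with E u v
  ... | true  = inj₁ refl
  ... | false = inj₂ refl

  by-adjacency : ∀ u v → (u ~ v → ⊥) → (u ≁ v → ⊥) → ⊥
  by-adjacency u v f g = [ f , g ]′ (adjacent? u v)

  adj : ∀ {u v} → (u ≁ v → ⊥) → u ~ v
  adj = ¬false⇒true

  nonadj : ∀ {u v} → (u ~ v → ⊥) → u ≁ v
  nonadj = ¬true⇒false

  NoBull NoHouse NoHammer NoC4 No2K2 NoDiamond : Set
  NoBull = ∀ {a b c d e} → a ~ b → a ~ c → b ~ c → a ~ d → b ~ e →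
    a ≁ e → b ≁ d → c ≁ d → c ≁ e → d ≁ e → ⊥
  NoHouse = ∀ {p q r s t} → p ~ q → q ~ r → r ~ s → s ~ p → p ≁ r → q ≁ s →
    t ~ p → t ~ q → t ≁ r → t ≁ s → ⊥
  NoHammer = ∀ {a b c d e} → a ~ b → a ~ c → b ~ c → a ~ d → d ~ e →
    b ≁ d → c ≁ d → a ≁ e → b ≁ e → c ≁ e → ⊥
  NoC4 = ∀ {a b c d} → a ~ b → b ~ c → c ~ d → d ~ a → a ≁ c → b ≁ d → a ≢ c → b ≢ d → ⊥
  No2K2 = ∀ {a b c d} → a ~ b → c ~ d → a ≁ c → a ≁ d → b ≁ c → b ≁ d → ⊥
  NoDiamond = ∀ {a b c d} → a ~ b → a ~ c → a ~ d → b ~ c → b ~ d → c ≁ d → c ≢ d → ⊥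

  Triangle : V → V → V → Set
  Triangle a b c = a ~ b × a ~ c × b ~ c

  Simplicial : V → Set
  Simplicial v = ∀ {a b} → v ~ a → v ~ b → a ≢ b → a ~ b

  -- Stated for arbitrary predicates, so that a component `Path C c` can be the homogeneous set
  -- without reachability being decided.
  Prime : Set₁
  Prime = (X : V → Set) → ∀ {x y z} → X x → X y → x ≢ y → ¬ X z →
    (∀ u → ¬ X u → ∀ {a b} → X a → X b → u ~ a → u ≁ b → ⊥) → ⊥

  infixl 5 _▷_∣_
  -- Both ends lie in `C` as well, so `Path C x` is the component of `x` in the subgraph induced on
  -- `C`.
  data Path (C : V → Set) (x : V) : V → Set where
    start : C x → Path C x x
    _▷_∣_ : ∀ {y z} → Path C x y → y ~ z → C z → Path C x z

  target : ∀ {C x y} → Path C x y → C y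
  target (start c)   = c
  target (_ ▷ _ ∣ c) = c

  source : ∀ {C x y} → Path C x y → C x
  source (start c)   = c
  source (p ▷ _ ∣ _) = source p

  map-path : ∀ {C D : V → Set} {x y} → (∀ {v} → C v → D v) → Path C x y → Path D x y
  map-path f (start c)   = start (f c)
  map-path f (p ▷ e ∣ c) = map-path f p ▷ e ∣ f c

  cons : ∀ {C x y z} → C x → x ~ y → Path C y z → Path C x z
  cons c e (start d)   = start c ▷ e ∣ d
  cons c e (p ▷ f ∣ d) = cons c e p ▷ f ∣ d

  join : ∀ {C x y z} → Path C x y → Path C x z → Path C y z
  join (start _)   q = q
  join (p ▷ e ∣ c) q = cons c (~-sym e) (join p q)

  cut : ∀ {C x y} (f : V → Bool) → Path C x y → f x ≡ true → f y ≡ false →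
    ∃ λ a → ∃ λ b → Path C x a × Path C x b × a ~ b × f a ≡ true × f b ≡ false
  cut f (start _) fx fy = ⊥-elim (true≢false fx fy)
  cut f (_▷_∣_ {y} {z} p e c) fx fz with f y in fy
  ... | true  = y , z , p , (p ▷ e ∣ c) , e , fy , fz
  ... | false = cut f p fx fy

  -- One of `x` and `y` is treated by `u` differently from `c`; the path from `c` to that vertex
  -- contains an edge on which `u` changes its mind.
  mixed-edge : ∀ {C c x y} u → Path C c x → Path C c y → u ~ x → u ≁ y →
    ∃ λ a → ∃ λ b → Path C c a × Path C c b × a ~ b × u ~ a × u ≁ b
  mixed-edge {c = c} u p q ux uy with adjacent? u c
  ... | inj₁ uc = cut (E u) q uc uy
  ... | inj₂ uc with cut (not ∘ E u) p (cong not uc) (cong not ux)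
  ...   | a , b , pa , pb , e , ua , ub = b , a , pb , pa , ~-sym e , not-false ub , not-true ua

  prime-component : Prime → ∀ {C c y z} → Path C c y → c ≢ y → ¬ Path C c z →
    (∀ {u a b} → ¬ Path C c u → Path C c a → Path C c b → a ~ b → u ~ a → u ≁ b → ⊥) → ⊥
  prime-component prime {C} {c} p c≢y ¬z h =
    prime (Path C c) (start (source p)) p c≢y ¬z λ u ¬u pa pb ua ub →
      case mixed-edge u pa pb ua ub of λ where
        (a , b , qa , qb , e , va , vb) → h ¬u qa qb e va vb

  connected : Prime → ∀ {t s} → t ~ s → ∀ z → ¬ ¬ Path (λ _ → ⊤) t z
  connected prime ts z ¬z = prime-component prime (start tt ▷ ts ∣ tt) (~⇒≢ ts) ¬z
    λ ¬u pa _ _ ua _ → ¬u (pa ▷ ~-sym ua ∣ tt)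

  C4-free⇒house-free : NoC4 → NoHouse
  C4-free⇒house-free noC4 pq qr rs sp pr qs tp tq tr ts =
    noC4 pq qr rs sp pr qs (λ { refl → clash tp tr }) (λ { refl → clash tq ts })

  -- Connected neighbourhoods in prime (bull, house)-free graphs

  module Neighbourhoods (prime : Prime) (no-bull : NoBull) (no-house : NoHouse)
    {t₁ t₂ t₃ : V} (triangle : Triangle t₁ t₂ t₃) where

    -- Otherwise some `u` is mixed on an edge `c d` of the component of `a` in N(v). Here `u` misses
    -- `v`, or it would lie in that component, and `z` misses `c` and `d`. If `z ~ u`, the square
    -- `v c u z` with roof `d` is a house; if not, `z` and `u` are the pendants of a bull on
    -- `v c d`.
    triangle-nbrs : ∀ {v a b z} → v ~ a → v ~ b → a ~ b → v ~ z → ¬ ¬ Path (v ~_) a z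
    triangle-nbrs {v} {a} {b} {z} va vb ab vz ¬z =
      prime-component prime (start va ▷ ab ∣ vb) (~⇒≢ ab) ¬z
        λ {u} {c} {d} ¬u pc pd cd uc ud →
          let vu = nonadj {v} {u} λ vu → ¬u (pc ▷ ~-sym uc ∣ vu)
              cz = nonadj {c} {z} λ cz → ¬z (pc ▷ cz ∣ vz)
              dz = nonadj {d} {z} λ dz → ¬z (pd ▷ dz ∣ vz)
              vc = target pc
              vd = target pd
          in by-adjacency z u
               (λ zu → no-house vc (~-sym uc) (~-sym zu) (~-sym vz) vu cz
                         (~-sym vd) (~-sym cd) (≁-sym ud) dz)
               (λ zu → no-bull vc vd cd vz (~-sym uc) vu cz dz (≁-sym ud) zu)

    InTriangle : V → Set
    InTriangle v = ∃ λ a → ∃ λ b → Triangle v a b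

    in-triangle-nbr : ∀ {v z} → InTriangle v → v ~ z → ¬ ¬ InTriangle z
    in-triangle-nbr {v} {z} (a , b , va , vb , ab) vz ¬tri = triangle-nbrs va vb ab vz λ where
      (start _)             → ¬tri (v , b , ~-sym vz , ab , vb)
      (_▷_∣_ {y} p e _)     → ¬tri (v , y , ~-sym vz , ~-sym e , target p)

    in-triangle : ∀ v → ¬ ¬ InTriangle v
    in-triangle v ¬tri = connected prime (proj₁ triangle) v λ p → along p ¬tri
      where
      along : ∀ {z} → Path (λ _ → ⊤) t₁ z → ¬ ¬ InTriangle z
      along (start _)   ¬tri = ¬tri (t₂ , t₃ , triangle)
      along (p ▷ e ∣ _) ¬tri = along p λ tri → in-triangle-nbr tri e ¬tri

    nbrs-connected : ∀ {v a b} → v ~ a → v ~ b → ¬ ¬ Path (v ~_) a b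
    nbrs-connected {v} va vb ¬p = in-triangle v λ where
      (_ , _ , vc , vd , cd) → triangle-nbrs vc vd cd va λ p →
        triangle-nbrs vc vd cd vb λ q → ¬p (join p q)

≟-true : ∀ {V : Set} (_≟_ : DecidableEquality V) {u v} → u ≡ v → ⌊ u ≟ v ⌋ ≡ true
≟-true _≟_ {u} {v} e with u ≟ v
... | yes _ = refl
... | no ne = ⊥-elim (ne e)

≟-false : ∀ {V : Set} (_≟_ : DecidableEquality V) {u v} → u ≢ v → ⌊ u ≟ v ⌋ ≡ false
≟-false _≟_ {u} {v} ne with u ≟ v
... | yes e = ⊥-elim (ne e)
... | no _  = refl

≟-sound : ∀ {V : Set} (_≟_ : DecidableEquality V) {u v} → ⌊ u ≟ v ⌋ ≡ true → u ≡ v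
≟-sound _≟_ {u} {v} h with u ≟ v
... | yes e = e

-- A simplicial vertex in prime (bull, C₄)-free graphs

module SimplicialVertex {V : Set} (_≟_ : DecidableEquality V) (vs : List V) (complete : ∀ v → v ∈ vs)
  (E : V → V → Bool) (E-sym : ∀ u v → E u v ≡ E v u) (E-irr : ∀ v → E v v ≡ false) where

  open Adjacency E E-sym E-irr

  module _ (prime : Prime) (no-bull : NoBull) (no-C4 : NoC4) {t₁ t₂ t₃ : V} (triangle : Triangle t₁ t₂ t₃) where

    open Neighbourhoods prime no-bull (C4-free⇒house-free no-C4) triangle

    closed : V → V → Bool
    closed v u = ⌊ u ≟ v ⌋ ∨ E v u

    closed-false : ∀ {v u} → u ≢ v → v ≁ u → closed v u ≡ false
    closed-false u≢v vu rewrite ≟-false _≟_ u≢v = vu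

    -- An edge `t u` closes the C₄ `a b u t`; a non-edge makes `t` and `u` the pendants of a bull.
    two-private : ∀ {a b c t u} → Triangle a b c → t ~ a → t ≁ b → t ≁ c → u ~ b → u ≁ a → u ≁ c → ⊥
    two-private {a} {b} {c} {t} {u} (ab , ac , bc) ta tb tc ub ua uc = by-adjacency t u
      (λ tu → no-C4 ab (~-sym ub) (~-sym tu) ta (≁-sym ua) (≁-sym tb) (separated ac uc) (separated bc tc))
      (λ tu → no-bull ab ac bc (~-sym ta) (~-sym ub) (≁-sym ua) (≁-sym tb) (≁-sym tc) (≁-sym uc) tu)

    module At (v : V) (smaller : ∀ u → count (closed u) vs < count (closed v) vs → ⊥) where

      Far : V → Set
      Far d = d ≢ v × v ≁ d

      -- Otherwise N[c] ⊆ N[v], and minimality of N[v] forces equality. Then `v` and `c` are twins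
      -- and {v, c} is homogeneous; a triangle at `v` supplies a vertex outside it.
      private-nbr : ∀ {c} → v ~ c → ¬ ¬ ∃ λ d → c ~ d × Far d
      private-nbr {c} vc none = in-triangle v λ where
          (a , b , va , vb , ab) → case a ≟ c of λ where
            (yes refl) → absorb {b} (λ { (inj₁ refl) → ~⇒≢ vb refl ; (inj₂ refl) → ~⇒≢ ab refl })
            (no a≢c)   → absorb {a} (λ { (inj₁ refl) → ~⇒≢ va refl ; (inj₂ refl) → a≢c refl })
        where
        within : ∀ {d} → c ~ d → d ≢ v → v ~ d
        within cd d≢v = adj λ vd → none (_ , cd , d≢v , vd)

        included : ∀ w → closed c w ≡ true → closed v w ≡ true
        included w h with w ≟ v
        ... | yes _ = refl
        ... | no w≢v with ∨-elim ⌊ w ≟ c ⌋ h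
        ...   | inj₁ e rewrite ≟-sound _≟_ e = vc
        ...   | inj₂ cw = within cw w≢v

        absorb : ∀ {z} → ¬ (z ≡ v ⊎ z ≡ c) → ⊥
        absorb ¬z = prime (λ u → u ≡ v ⊎ u ≡ c) (inj₁ refl) (inj₂ refl) (~⇒≢ vc) ¬z λ where
          u ¬u (inj₁ refl) (inj₁ refl) ua ub → clash ua ub
          u ¬u (inj₂ refl) (inj₂ refl) ua ub → clash ua ub
          u ¬u (inj₂ refl) (inj₁ refl) ua ub → clash (within (~-sym ua) (¬u ∘ inj₁)) (≁-sym ub)
          u ¬u (inj₁ refl) (inj₂ refl) ua ub → smaller c
            (count-strict included {u} (∨-inʳ ⌊ u ≟ v ⌋ (~-sym ua)) (closed-false (¬u ∘ inj₂) (≁-sym ub)) (complete u))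

      common-nbrs : ∀ {d c c′} → Far d → v ~ c → v ~ c′ → d ~ c → d ~ c′ → c ≢ c′ → c ~ c′
      common-nbrs (d≢v , vd) vc vc′ dc dc′ c≢c′ = adj λ cc′ →
        no-C4 vc (~-sym dc) dc′ (~-sym vc′) vd cc′ (≢-sym d≢v) c≢c′

      module InducedP3 {c q c′} (vc : v ~ c) (vq : v ~ q) (vc′ : v ~ c′)
        (cq : c ~ q) (qc′ : q ~ c′) (cc′ : c ≁ c′) (c≢c′ : c ≢ c′) where

        -- Suppose `q` misses `d`. By `two-private`, a far neighbour `e` of `q` is adjacent to `c`,
        -- hence not to `c′`. Then a far neighbour `d′` of `c′` is adjacent to `q` but not to `c`,
        -- and `two-private` applies to the triangle `c q v` with `d` and `d′`.
        centre-sees : ∀ {d} → Far d → c ~ d → q ~ d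
        centre-sees {d} far-d@(_ , vd) cd = adj λ qd → private-nbr vq λ where
          (e , qe , far-e@(_ , ve)) →
            let ce = adj {c} {e} λ ce → two-private (cq , ~-sym vc , ~-sym vq)
                       (~-sym cd) (≁-sym qd) (≁-sym vd) (~-sym qe) (≁-sym ce) (≁-sym ve)
                c′e = nonadj {c′} {e} λ c′e → clash (common-nbrs far-e vc vc′ (~-sym ce) (~-sym c′e) c≢c′) cc′
            in private-nbr vc′ λ where
              (d′ , c′d′ , far-d′@(_ , vd′)) →
                let qd′ = adj {q} {d′} λ qd′ → two-private (qc′ , ~-sym vq , ~-sym vc′)
                            (~-sym qe) (≁-sym c′e) (≁-sym ve) (~-sym c′d′) (≁-sym qd′) (≁-sym vd′)
                    cd′ = nonadj {c} {d′} λ cd′ → clash (common-nbrs far-d′ vc vc′ (~-sym cd′) (~-sym c′d′) c≢c′) cc′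
                in two-private (cq , ~-sym vc , ~-sym vq)
                     (~-sym cd) (≁-sym qd) (≁-sym vd) (~-sym qd′) (≁-sym cd′) (≁-sym vd′)

      Central : V → Set
      Central x = v ~ x × (∀ r → v ~ r → r ≢ x → x ~ r)

      -- The far neighbours `d` of `c` and `d′` of `c′` are both seen by `q`. A neighbour `r` of `v`
      -- missing `q` then has to see both `c` and `c′`, since otherwise `r` and one of `d`, `d′` are
      -- private; this leaves the C₄ `c q c′ r`.
      central : ∀ {c q c′} → v ~ c → v ~ q → v ~ c′ → c ~ q → q ~ c′ → c ≁ c′ → c ≢ c′ → Central q
      central {c} {q} {c′} vc vq vc′ cq qc′ cc′ c≢c′ = vq , λ r vr r≢q → adj λ qr →
        private-nbr vc λ where
          (d , cd , far-d@(_ , vd)) → private-nbr vc′ λ where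
            (d′ , c′d′ , far-d′@(_ , vd′)) →
              let qd  = P3.centre-sees far-d cd
                  qd′ = P3ʳ.centre-sees far-d′ c′d′
                  c′d = nonadj {c′} {d} λ c′d → clash (common-nbrs far-d vc vc′ (~-sym cd) (~-sym c′d) c≢c′) cc′
                  cd′ = nonadj {c} {d′} λ cd′ → clash (common-nbrs far-d′ vc vc′ (~-sym cd′) (~-sym c′d′) c≢c′) cc′
                  rc  = adj {r} {c} λ rc → two-private (~-sym vq , ~-sym cq , vc)
                          (~-sym qd′) (≁-sym vd′) (≁-sym cd′) (~-sym vr) (≁-sym qr) rc
                  rc′ = adj {r} {c′} λ rc′ → two-private (~-sym vq , qc′ , vc′)
                          (~-sym qd) (≁-sym vd) (≁-sym c′d) (~-sym vr) (≁-sym qr) rc′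
              in no-C4 cq qc′ (~-sym rc′) rc cc′ qr c≢c′ (≢-sym r≢q)
        where
        module P3  = InducedP3 vc vq vc′ cq qc′ cc′ c≢c′
        module P3ʳ = InducedP3 vc′ vq vc (~-sym qc′) (~-sym cq) (≁-sym cc′) (≢-sym c≢c′)

      central-sees : ∀ {x l d} → Central x → v ~ l → ¬ Central l → Far d → d ~ l → x ~ d
      central-sees {x} {l} {d} (vx , x-all) vl ¬cl far dl = adj λ xd → ¬cl (vl , λ r vr r≢l → adj λ lr →
        let xl = x-all l vl λ { refl → ¬cl (vx , x-all) }
            xr = x-all r vr λ { refl → clash xl (≁-sym lr) }
        in clash (InducedP3.centre-sees vl vx vr (~-sym xl) xr lr (≢-sym r≢l) far (~-sym dl)) xd)

      Reached : V → V → Set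
      Reached x = Path (λ u → ¬ Central u × x ~ u) v

      -- The path is kept inside N(x), so that an edge `a b` on which a bad `t` is mixed forms a
      -- triangle with `x`, and `t` is private to `a`. It remains to find a vertex private to `x`:
      -- either `v`, or, if `v` sees `b`, a neighbour of `v` that misses `b`. If `v` sees `a`, then
      -- `central-sees` already gives `x ~ t`.
      central-complete : ∀ {x s} → Central x → Path (¬_ ∘ Central) v s → Reached x s
      central-complete {x} cx@(vx , _) (start ¬cv) = start (¬cv , ~-sym vx)
      central-complete {x} cx@(vx , x-all) (_▷_∣_ {s} {t} p st ¬ct) = reached ▷ st ∣ (¬ct , adj λ xt → contra xt)
        where
        reached : Reached x s
        reached = central-complete cx p

        contra : x ≁ t → ⊥
        contra xt = case mixed-edge t reached (start (source reached)) (~-sym st) (≁-sym vt) of λ where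
            (a , b , pa , pb , ab , ta , tb) → no-mixed a b (target pa) (target pb) ab ta tb
          where
          vt : v ≁ t
          vt = nonadj λ vt → clash (x-all t vt λ { refl → ¬ct cx }) xt

          far-t : Far t
          far-t = (λ { refl → clash (~-sym vx) xt }) , vt

          no-mixed : ∀ a b → ¬ Central a × x ~ a → ¬ Central b × x ~ b → a ~ b → t ~ a → t ≁ b → ⊥
          no-mixed a b (¬ca , xa) (¬cb , xb) ab ta tb = by-adjacency v a
              (λ va → clash (central-sees cx va ¬ca far-t ta) xt)
              (λ va → by-adjacency v b
                (λ vb → ¬cb (vb , λ r vr r≢b → adj λ br →
                  let far-a = (λ { refl → clash (~-sym ta) vt }) , va
                      xr = x-all r vr λ { refl → clash (~-sym xb) br }
                      ar = nonadj {a} {r} λ ar → clash (common-nbrs far-a vb vr ab ar (≢-sym r≢b)) br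
                  in dominated (~-sym xr) (≁-sym ar) (≁-sym br)))
                (λ vb → dominated vx va vb))
            where
            dominated : ∀ {u} → u ~ x → u ≁ a → u ≁ b → ⊥
            dominated = two-private (~-sym xa , ab , xb) ta (≁-sym xt) tb

      -- A path in N(v) between nonadjacent `a` and `b` leaves N[a], which gives an induced P₃ and
      -- hence a central vertex. The component of `v` among the non-central vertices contains `a`,
      -- which is not central because it misses `b`, so this component is a nontrivial homogeneous
      -- set.
      simplicial : ¬ ¬ Simplicial v
      simplicial ¬simp = ¬simp λ {a} {b} va vb a≢b → adj λ ab → nbrs-connected va vb λ p →
          case cut (closed a) p (∨-inˡ (≟-true _≟_ refl)) (closed-false (≢-sym a≢b) ab) of λ where
            (q , c′ , pq , pc′ , qc′ , aq , ac′) → induced-P3 va vb a≢b ab (target pq) (target pc′) qc′ aq ac′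
        where
        induced-P3 : ∀ {a b q c′} → v ~ a → v ~ b → a ≢ b → a ≁ b → v ~ q → v ~ c′ → q ~ c′ →
          closed a q ≡ true → closed a c′ ≡ false → ⊥
        induced-P3 {a} {b} {q} {c′} va vb a≢b ab vq vc′ qc′ aq ac′ with q ≟ a | c′ ≟ a
        ... | yes refl | no _ = clash qc′ ac′
        ... | no _ | no c′≢a =
          let cq = central va vq vc′ aq qc′ ac′ (≢-sym c′≢a)
          in prime-component prime
               (start (λ { (vv , _) → ~⇒≢ vv refl }) ▷ va ∣ λ { (_ , all) → clash (all b vb (≢-sym a≢b)) ab })
               (~⇒≢ va) (λ p → target p cq)
               λ ¬u pa pb _ ua ub → ¬u (pa ▷ ~-sym ua ∣ λ cu →
                 clash (proj₂ (target (central-complete cu pb))) ub)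

    simplicial-exists : ¬ (∀ v → ¬ Simplicial v)
    simplicial-exists none = go t₁ (<-wellFounded _)
      where
      go : ∀ v → Acc _<_ (count (closed v) vs) → ⊥
      go v (acc rs) = At.simplicial v (λ u lt → go u (rs lt)) (none v)

-- Maximal pairs of anticomplete connected sets

module Pairs {V : Set} (_≟_ : DecidableEquality V) (vs : List V) (complete : ∀ v → v ∈ vs)
  (E : V → V → Bool) (E-sym : ∀ u v → E u v ≡ E v u) (E-irr : ∀ v → E v v ≡ false) where

  open Adjacency E E-sym E-irr

  -- Taken in the graph itself for the hammer and in its complement for the house. A 2K₂ is the
  -- smallest such pair.
  record Pair : Set where
    field
      X Y         : V → Bool
      a a′ c c′   : V
      a∈X         : X a ≡ true
      a′∈X        : X a′ ≡ true
      c∈Y         : Y c ≡ true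
      c′∈Y        : Y c′ ≡ true
      a~a′        : a ~ a′
      c~c′        : c ~ c′
      X-connected : ∀ {x} → X x ≡ true → Path (λ v → X v ≡ true) a x
      Y-connected : ∀ {y} → Y y ≡ true → Path (λ v → Y v ≡ true) c y
      X≁Y         : ∀ {x y} → X x ≡ true → Y y ≡ true → x ≁ y
      Y≁X         : ∀ {y x} → Y y ≡ true → X x ≡ true → y ≁ x
      disjoint    : ∀ {x} → X x ≡ true → Y x ≡ true → ⊥
  open Pair public

  -- The pair stores X≁Y in both orientations to make swap a definitional involution.
  swap : Pair → Pair
  swap P = record
    { X = Y P ; Y = X P ; a = c P ; a′ = c′ P ; c = a P ; c′ = a′ P
    ; a∈X = c∈Y P ; a′∈X = c′∈Y P ; c∈Y = a∈X P ; c′∈Y = a′∈X P ; a~a′ = c~c′ P ; c~c′ = a~a′ P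
    ; X-connected = Y-connected P ; Y-connected = X-connected P
    ; X≁Y = Y≁X P ; Y≁X = X≁Y P ; disjoint = λ x y → disjoint P y x }

  Maximal : Pair → Set
  Maximal P = ∀ {u x} → X P u ≡ false → Y P u ≡ false → X P x ≡ true → u ~ x →
    (∀ y → Y P y ≡ true → u ≁ y) → ⊥

  extend : ∀ P {u x} → X P u ≡ false → Y P u ≡ false → X P x ≡ true → u ~ x →
    (∀ y → Y P y ≡ true → u ≁ y) → Pair
  extend P {u} {x} Xu Yu Xx ux uY = record
    { X = X⁺ ; Y = Y P ; a = a P ; a′ = a′ P ; c = c P ; c′ = c′ P
    ; a∈X = ∨-inˡ (a∈X P) ; a′∈X = ∨-inˡ (a′∈X P) ; c∈Y = c∈Y P ; c′∈Y = c′∈Y P ; a~a′ = a~a′ P ; c~c′ = c~c′ P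
    ; X-connected = connected⁺ ; Y-connected = Y-connected P
    ; X≁Y = X⁺≁Y ; Y≁X = λ Yy Xv → ≁-sym (X⁺≁Y Xv Yy) ; disjoint = disjoint⁺ }
    where
    X⁺ : V → Bool
    X⁺ v = X P v ∨ ⌊ v ≟ u ⌋

    connected⁺ : ∀ {y} → X⁺ y ≡ true → Path (λ v → X⁺ v ≡ true) (a P) y
    connected⁺ {y} h with ∨-elim (X P y) h
    ... | inj₁ Xy = map-path ∨-inˡ (X-connected P Xy)
    ... | inj₂ e rewrite ≟-sound _≟_ e =
      map-path ∨-inˡ (X-connected P Xx) ▷ ~-sym ux ∣ ∨-inʳ (X P u) (≟-true _≟_ refl)

    X⁺≁Y : ∀ {v y} → X⁺ v ≡ true → Y P y ≡ true → v ≁ y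
    X⁺≁Y {v} h Yy with ∨-elim (X P v) h
    ... | inj₁ Xv = X≁Y P Xv Yy
    ... | inj₂ e rewrite ≟-sound _≟_ e = uY _ Yy

    disjoint⁺ : ∀ {v} → X⁺ v ≡ true → Y P v ≡ true → ⊥
    disjoint⁺ {v} h Yv with ∨-elim (X P v) h
    ... | inj₁ Xv = disjoint P Xv Yv
    ... | inj₂ e rewrite ≟-sound _≟_ e = true≢false Yv Yu

  outside : Pair → ℕ
  outside P = count (λ v → not (X P v ∨ Y P v)) vs

  module _ {P : Pair} {u : V} where

    shrinks : ∀ {x} Xu Yu (Xx : X P x ≡ true) ux uY → outside (extend P {u} Xu Yu Xx ux uY) < outside P
    shrinks Xu Yu Xx ux uY = count-strict weaken {u} in-P not-in-P⁺ (complete u)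
      where
      weaken : ∀ v → not ((X P v ∨ ⌊ v ≟ u ⌋) ∨ Y P v) ≡ true → not (X P v ∨ Y P v) ≡ true
      weaken v h with X P v | Y P v
      weaken v () | true  | _
      weaken v h  | false | false = refl
      weaken v h  | false | true with ⌊ v ≟ u ⌋
      weaken v () | false | true | true
      weaken v () | false | true | false

      in-P : not (X P u ∨ Y P u) ≡ true
      in-P rewrite Xu | Yu = refl

      not-in-P⁺ : not ((X P u ∨ ⌊ u ≟ u ⌋) ∨ Y P u) ≡ false
      not-in-P⁺ rewrite Xu | ≟-true _≟_ {u} refl = refl

  outside-swap : ∀ P → outside (swap P) ≤ outside P
  outside-swap P = count-mono flip vs
    where
    flip : ∀ v → not (Y P v ∨ X P v) ≡ true → not (X P v ∨ Y P v) ≡ true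
    flip v h with X P v | Y P v
    flip v h | false | false = refl

  maximal-pair : Pair → ¬ (∀ P → Maximal P → Maximal (swap P) → ⊥)
  maximal-pair P₀ found = go P₀ (<-wellFounded _)
    where
    go : ∀ P → Acc _<_ (outside P) → ⊥
    go P (acc rs) = found P
      (λ Xu Yu Xx ux uY → go (extend P Xu Yu Xx ux uY) (rs (shrinks {P} Xu Yu Xx ux uY)))
      (λ Xu Yu Xx ux uY → go (extend (swap P) Xu Yu Xx ux uY)
        (rs (ℕₚ.<-≤-trans (shrinks {swap P} Xu Yu Xx ux uY) (outside-swap P))))

  2K2-pair : ∀ {p q r s} → p ~ q → r ~ s → p ≁ r → p ≁ s → q ≁ r → q ≁ s → Pair
  2K2-pair {p} {q} {r} {s} pq rs pr ps qr qs = record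
    { X = pair p q ; Y = pair r s ; a = p ; a′ = q ; c = r ; c′ = s
    ; a∈X = inˡ ; a′∈X = inʳ p ; c∈Y = inˡ ; c′∈Y = inʳ r ; a~a′ = pq ; c~c′ = rs
    ; X-connected = link pq ; Y-connected = link rs ; X≁Y = apart ; Y≁X = λ h k → ≁-sym (apart k h) ; disjoint = distinct }
    where
    pair : V → V → V → Bool
    pair x y v = ⌊ v ≟ x ⌋ ∨ ⌊ v ≟ y ⌋

    inˡ : ∀ {x y} → pair x y x ≡ true
    inˡ {x} = ∨-inˡ (≟-true _≟_ {x} refl)

    inʳ : ∀ x {y} → pair x y y ≡ true
    inʳ x {y} = ∨-inʳ ⌊ y ≟ x ⌋ (≟-true _≟_ refl)

    pair⁻ : ∀ {x y v} → pair x y v ≡ true → v ≡ x ⊎ v ≡ y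
    pair⁻ {x} {y} {v} h with ∨-elim ⌊ v ≟ x ⌋ h
    ... | inj₁ e = inj₁ (≟-sound _≟_ e)
    ... | inj₂ e = inj₂ (≟-sound _≟_ e)

    link : ∀ {x y v} → x ~ y → pair x y v ≡ true → Path (λ v → pair x y v ≡ true) x v
    link {x} xy h with pair⁻ h
    ... | inj₁ refl = start inˡ
    ... | inj₂ refl = start inˡ ▷ xy ∣ inʳ x

    apart : ∀ {x y} → pair p q x ≡ true → pair r s y ≡ true → x ≁ y
    apart h k with pair⁻ h | pair⁻ k
    ... | inj₁ refl | inj₁ refl = pr
    ... | inj₁ refl | inj₂ refl = ps
    ... | inj₂ refl | inj₁ refl = qr
    ... | inj₂ refl | inj₂ refl = qs

    distinct : ∀ {x} → pair p q x ≡ true → pair r s x ≡ true → ⊥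
    distinct h k with pair⁻ h | pair⁻ k
    ... | inj₁ refl | inj₁ refl = clash rs ps
    ... | inj₁ refl | inj₂ refl = clash (~-sym rs) pr
    ... | inj₂ refl | inj₁ refl = clash rs qs
    ... | inj₂ refl | inj₂ refl = clash (~-sym rs) qr

-- Complementation

module Complement {V : Set} (_≟_ : DecidableEquality V)
  (E : V → V → Bool) (E-sym : ∀ u v → E u v ≡ E v u) (E-irr : ∀ v → E v v ≡ false) where

  open Adjacency E E-sym E-irr

  co : V → V → Bool
  co u v = not ⌊ u ≟ v ⌋ ∧ not (E u v)

  co-in : ∀ {u v} → u ≢ v → u ≁ v → co u v ≡ true
  co-in u≢v uv rewrite ≟-false _≟_ u≢v | uv = refl

  co-out : ∀ {u v} → u ~ v → co u v ≡ false
  co-out {u} {v} uv with u ≟ v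
  ... | yes _ = refl
  ... | no _ rewrite uv = refl

  co-irr : ∀ v → co v v ≡ false
  co-irr v rewrite ≟-true _≟_ {v} refl = refl

  co⇒≢ : ∀ {u v} → co u v ≡ true → u ≢ v
  co⇒≢ {u} h refl = true≢false h (co-irr u)

  co⇒≁ : ∀ {u v} → co u v ≡ true → u ≁ v
  co⇒≁ h = nonadj λ uv → true≢false h (co-out uv)

  ¬co⇒~ : ∀ {u v} → u ≢ v → co u v ≡ false → u ~ v
  ¬co⇒~ u≢v h = adj λ uv → true≢false (co-in u≢v uv) h

  co-sym : ∀ u v → co u v ≡ co v u
  co-sym u v with co u v in p | co v u in q
  ... | true  | true  = refl
  ... | false | false = refl
  ... | true  | false = ⊥-elim (true≢false (co-in (≢-sym (co⇒≢ p)) (≁-sym (co⇒≁ p))) q)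
  ... | false | true  = ⊥-elim (true≢false (co-in (≢-sym (co⇒≢ q)) (≁-sym (co⇒≁ q))) p)

  module Co = Adjacency co co-sym co-irr

  co-prime : Prime → Co.Prime
  co-prime prime X Xx Xy x≢y ¬Xz h = prime X Xx Xy x≢y ¬Xz λ u ¬u Xa Xb ua ub →
    h u ¬u Xb Xa (co-in (λ { refl → ¬u Xb }) ub) (co-out ua)

  -- The bull is self-complementary: complementing turns `d e c` into the triangle, with pendants
  -- `b` at `d` and `a` at `e`.
  co-bull-free : NoBull → Co.NoBull
  co-bull-free no-bull {a} {b} {c} {d} {e} ab ac bc ad be ae bd cd ce de = no-bull
    (¬co⇒~ d≢e de) (¬co⇒~ (≢-sym c≢d) (Co.≁-sym cd)) (¬co⇒~ (≢-sym c≢e) (Co.≁-sym ce))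
    (¬co⇒~ (≢-sym b≢d) (Co.≁-sym bd)) (¬co⇒~ (≢-sym a≢e) (Co.≁-sym ae))
    (≁-sym (co⇒≁ ad)) (≁-sym (co⇒≁ be)) (≁-sym′ bc) (≁-sym′ ac) (≁-sym′ ab)
    where
    ≁-sym′ : ∀ {u v} → co u v ≡ true → v ≁ u
    ≁-sym′ h = ≁-sym (co⇒≁ h)
    d≢e : d ≢ e
    d≢e = Co.separated (Co.~-sym ad) (Co.≁-sym ae)
    c≢d : c ≢ d
    c≢d = Co.separated (Co.~-sym bc) (Co.≁-sym bd)
    c≢e : c ≢ e
    c≢e = Co.separated (Co.~-sym ac) (Co.≁-sym ae)
    b≢d : b ≢ d
    b≢d = Co.separated be de
    a≢e : a ≢ e
    a≢e = Co.separated ad (Co.≁-sym de)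

  co-C4-free : No2K2 → Co.NoC4
  co-C4-free no-2K2 ab bc cd da ac bd a≢c b≢d = no-2K2 (¬co⇒~ a≢c ac) (¬co⇒~ b≢d bd)
    (co⇒≁ ab) (≁-sym (co⇒≁ da)) (≁-sym (co⇒≁ bc)) (co⇒≁ cd)

-- House-free graphs: no C₄

module House {V : Set} (_≟_ : DecidableEquality V) (vs : List V) (complete : ∀ v → v ∈ vs)
  (E : V → V → Bool) (E-sym : ∀ u v → E u v ≡ E v u) (E-irr : ∀ v → E v v ≡ false) where

  open Adjacency E E-sym E-irr
  open Complement _≟_ E E-sym E-irr
  open Pairs _≟_ vs complete co co-sym co-irr

  module _ (prime : Prime) (no-bull : NoBull) (no-house : NoHouse) where

    -- A maximal pair of the complement graph: in the graph itself X and Y are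
    -- co-connected and complete to each other.
    module Side (P : Pair) (maxX : Maximal P) (maxY : Maximal (swap P)) where

      ∈X ∈Y : V → Set
      ∈X v = X P v ≡ true
      ∈Y v = Y P v ≡ true

      Outside : V → Set
      Outside u = X P u ≡ false × Y P u ≡ false

      X~Y : ∀ {x y} → ∈X x → ∈Y y → x ~ y
      X~Y Xx Yy = ¬co⇒~ (λ { refl → disjoint P Xx Yy }) (X≁Y P Xx Yy)

      sees-all-Y⇒sees-X : ∀ {u} → Outside u → (∀ y → ∈Y y → u ~ y) → ∀ x → ∈X x → u ~ x
      sees-all-Y⇒sees-X (Xu , Yu) uY x Xx = adj λ ux →
        maxX Xu Yu Xx (co-in (λ { refl → true≢false Xx Xu }) ux) λ y Yy → co-out (uY y Yy)

      sees-all-X⇒sees-Y : ∀ {u} → Outside u → (∀ x → ∈X x → u ~ x) → ∀ y → ∈Y y → u ~ y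
      sees-all-X⇒sees-Y (Xu , Yu) uX y Yy = adj λ uy →
        maxY Yu Xu Yy (co-in (λ { refl → true≢false Yy Yu }) uy) λ x Xx → co-out (uX x Xx)

      Full : V → Set
      Full o = (∀ x → ∈X x → o ~ x) × (∀ y → ∈Y y → o ~ y)

      -- Co-connectedness yields nonadjacent `a`, `b` in X and nonadjacent `c`, `d` in Y of which
      -- `u` sees just `a` and `c`. The C₄ `a c b d` with roof `u` is a house.
      not-both-mixed : ∀ {u x x₀ y y₀} → Outside u → ∈X x → ∈X x₀ → u ~ x → u ≁ x₀ →
        ∈Y y → ∈Y y₀ → u ~ y → u ≁ y₀ → ⊥
      not-both-mixed {u} {x} {x₀} {y} {y₀} (Xu , Yu) Xx Xx₀ ux ux₀ Yy Yy₀ uy uy₀ =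
        case Co.mixed-edge u (X-connected P Xx₀) (X-connected P Xx) (co-in (λ { refl → true≢false Xx₀ Xu }) ux₀) (co-out ux) of λ where
          (b , a , pb , pa , ba , ub , ua) →
            case Co.mixed-edge u (Y-connected P Yy₀) (Y-connected P Yy) (co-in (λ { refl → true≢false Yy₀ Yu }) uy₀) (co-out uy) of λ where
              (d , c , pd , pc , dc , ud , uc) →
                let Xa = Co.target pa
                    Xb = Co.target pb
                    Yc = Co.target pc
                    Yd = Co.target pd
                in no-house (X~Y Xa Yc) (~-sym (X~Y Xb Yc)) (X~Y Xb Yd) (~-sym (X~Y Xa Yd))
                     (≁-sym (co⇒≁ ba)) (≁-sym (co⇒≁ dc))
                     (¬co⇒~ (λ { refl → true≢false Xa Xu }) ua) (¬co⇒~ (λ { refl → true≢false Yc Yu }) uc)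
                     (co⇒≁ ub) (co⇒≁ ud)

      -- If `u` missed a vertex of X it would be mixed on X, hence not on Y, hence complete to Y;
      -- maximality would then make it complete to X after all.
      one-sided : ∀ {u x y} → Outside u → ¬ Full u → ∈X x → u ~ x → ∈Y y → u ~ y → ⊥
      one-sided {u} out ¬full Xx ux Yy uy = ¬full (uX , sees-all-X⇒sees-Y out uX)
        where
        uX : ∀ x₀ → ∈X x₀ → u ~ x₀
        uX x₀ Xx₀ = adj λ ux₀ →
          clash (sees-all-Y⇒sees-X out (λ y₀ Yy₀ → adj λ uy₀ → not-both-mixed out Xx Xx₀ ux ux₀ Yy Yy₀ uy uy₀) x₀ Xx₀) ux₀

      record MixedX (u : V) : Set where
        field
          {yes-nbr no-nbr} : V
          out    : Outside u
          yes∈X  : ∈X yes-nbr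
          no∈X   : ∈X no-nbr
          sees   : u ~ yes-nbr
          misses : u ≁ no-nbr

        not-full : ¬ Full u
        not-full (uX , _) = clash (uX _ no∈X) misses

        anti-Y : ∀ {y} → ∈Y y → u ≁ y
        anti-Y Yy = nonadj λ uy → one-sided out not-full yes∈X sees Yy uy

      -- Primality applied to X; the mixed vertex is not in Y because Y is complete to X.
      mixed-exists : ¬ (∀ {u} → MixedX u → ⊥)
      mixed-exists h = prime ∈X (a∈X P) (a′∈X P) (co⇒≢ (a~a′ P)) (λ Xc → disjoint P Xc (c∈Y P))
        λ u ¬Xu {a} {b} Xa Xb ua ub → h {u} record
          { out = ¬true⇒false ¬Xu , ¬true⇒false λ Yu → clash (X~Y Xb Yu) (≁-sym ub)
          ; yes∈X = Xa ; no∈X = Xb ; sees = ua ; misses = ub }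

    module Stable (P : Pair) (maxX : Maximal P) (maxY : Maximal (swap P)) where
      open Side P maxX maxY public
      module S = Side (swap P) maxY maxX
      open MixedX
      open S.MixedX using () renaming (anti-Y to anti-X)

      -- Otherwise some `u` outside X is mixed on an edge `a b` of X. Take `p` mixed on Y with a
      -- neighbour `y` in Y. If `u ~ p`, the square `a y p u` with roof `b` is a house; if not, `u`
      -- and `p` are the pendants of a bull on `a y b`.
      X-stable : ∀ {x y} → ∈X x → ∈X y → x ≁ y
      X-stable {x} {y} Xx Xy = nonadj λ xy → prime-component prime (start Xx ▷ xy ∣ Xy) (~⇒≢ xy)
        (λ p → disjoint P (target p) (c∈Y P))
        λ {u} {a} {b} ¬u pa pb ab ua ub →
          let Xa = target pa
              Xb = target pb
              mu : MixedX u
              mu = record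
                { out = (¬true⇒false λ Xu → ¬u (pa ▷ ~-sym ua ∣ Xu)) , (¬true⇒false λ Yu → clash (X~Y Xb Yu) (≁-sym ub))
                ; yes∈X = Xa ; no∈X = Xb ; sees = ua ; misses = ub }
          in S.mixed-exists λ {p} mp →
            let y  = S.MixedX.yes-nbr mp
                Yy = S.MixedX.yes∈X mp
                py = S.MixedX.sees mp
                ap = ≁-sym (anti-X mp Xa)
                bp = ≁-sym (anti-X mp Xb)
                yu = ≁-sym (anti-Y mu Yy)
            in by-adjacency u p
                 (λ up → no-house (X~Y Xa Yy) (~-sym py) (~-sym up) ua ap yu
                           (~-sym ab) (X~Y Xb Yy) bp (≁-sym ub))
                 (λ up → no-bull (X~Y Xa Yy) ab (~-sym (X~Y Xb Yy)) (~-sym ua) (~-sym py)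
                           ap yu (≁-sym ub) bp up)

      -- Let `y` be a neighbour of `p′` in Y. The vertices `o`, `y`, `p`, `p′`, together with a
      -- vertex of X missed by `p` if `o ~ p` and seen by `p` otherwise, induce a house or a bull
      -- according to whether `p ~ p′`.
      full-sees-mixed : ∀ {o p p′} → Full o → MixedX p → S.MixedX p′ → o ~ p′
      full-sees-mixed {o} {p} {p′} (oX , oY) mp mp′ = adj λ op′ → by-adjacency o p
          (λ op → by-adjacency p p′
            (λ pp′ → no-house oy yp′ (~-sym pp′) (~-sym op) op′ yp (~-sym ox₂) x₂y x₂p′ (≁-sym (misses mp)))
            (λ pp′ → no-bull oy ox₂ (~-sym x₂y) op yp′ op′ yp (≁-sym (misses mp)) x₂p′ pp′))
          (λ op → by-adjacency p p′
            (λ pp′ → no-house x₁y yp′ (~-sym pp′) (sees mp) x₁p′ yp ox₁ oy op′ op)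
            (λ pp′ → no-bull x₁y (~-sym ox₁) (~-sym oy) (~-sym (sees mp)) yp′ x₁p′ yp op op′ pp′))
        where
        Yy : ∈Y (S.MixedX.yes-nbr mp′)
        Yy = S.MixedX.yes∈X mp′
        oy : o ~ S.MixedX.yes-nbr mp′
        oy = oY _ Yy
        yp′ : S.MixedX.yes-nbr mp′ ~ p′
        yp′ = ~-sym (S.MixedX.sees mp′)
        yp : S.MixedX.yes-nbr mp′ ≁ p
        yp = ≁-sym (anti-Y mp Yy)
        ox₁ : o ~ yes-nbr mp
        ox₁ = oX _ (yes∈X mp)
        ox₂ : o ~ no-nbr mp
        ox₂ = oX _ (no∈X mp)
        x₁y : yes-nbr mp ~ S.MixedX.yes-nbr mp′
        x₁y = X~Y (yes∈X mp) Yy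
        x₂y : no-nbr mp ~ S.MixedX.yes-nbr mp′
        x₂y = X~Y (no∈X mp) Yy
        x₁p′ : yes-nbr mp ≁ p′
        x₁p′ = ≁-sym (anti-X mp′ (yes∈X mp))
        x₂p′ : no-nbr mp ≁ p′
        x₂p′ = ≁-sym (anti-X mp′ (no∈X mp))

      unmixed-anti : ∀ {t} → Outside t → ¬ Full t → ¬ MixedX t → ∀ {x} → ∈X x → t ≁ x
      unmixed-anti {t} out ¬full ¬mixed {x} Xx = nonadj λ tx →
        let tX : ∀ x₀ → ∈X x₀ → t ~ x₀
            tX x₀ Xx₀ = adj λ tx₀ → ¬mixed record { out = out ; yes∈X = Xx ; no∈X = Xx₀ ; sees = tx ; misses = tx₀ }
        in ¬full (tX , sees-all-X⇒sees-Y out tX)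

    module Centre (P : Pair) (maxX : Maximal P) (maxY : Maximal (swap P)) where
      open Stable P maxX maxY public
      module T = Stable (swap P) maxY maxX

      swap-full : ∀ {o} → Full o → S.Full o
      swap-full (oX , oY) = oY , oX

      sees-mixed : ∀ {o p} → Full o → MixedX p → o ~ p
      sees-mixed full mp = adj λ op → S.mixed-exists λ mp′ →
        clash (T.full-sees-mixed (swap-full full) mp′ mp) op

      X-not-full : ∀ {x} → ∈X x → ¬ Full x
      X-not-full Xx (xX , _) = ~⇒≢ (xX _ Xx) refl

      -- A bull on the triangle o s s′ with pendant t at s and pendant x at o,
      -- where x is chosen in X ∪ Y.
      no-exit : ∀ {o s s′ t} → Full o → (∀ {x} → ∈X x → t ≁ x) → (∀ {y} → ∈Y y → t ≁ y) →
        Outside s → ¬ Full s → ¬ Full s′ → o ~ s → o ~ s′ → s ~ s′ → t ~ s → t ≁ s′ → o ≁ t →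
        (∀ {x} → ∈X x → s ≁ x) → ⊥
      no-exit {o} {s} {s′} {t} (oX , oY) tX tY out-s ¬fs ¬fs′ os os′ ss′ ts ts′ ot sX with Y P s′ in Ys′
      ... | true = clash (sees-all-Y⇒sees-X out-s
              (λ y Yy → adj λ sy → no-pendant (oY y Yy) sy (T.X-stable Ys′ Yy) (tY Yy)) _ (a∈X P)) (sX (a∈X P))
        where
        no-pendant : ∀ {x} → o ~ x → s ≁ x → s′ ≁ x → t ≁ x → ⊥
        no-pendant ox sx s′x tx = no-bull (~-sym os) ss′ os′ (~-sym ts) ox sx ot (≁-sym ts′) s′x tx
      ... | false = ¬fs′ (s′X , sees-all-X⇒sees-Y out-s′ s′X)
        where
        out-s′ : Outside s′
        out-s′ = (¬true⇒false λ Xs′ → clash ss′ (sX Xs′)) , Ys′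
        s′X : ∀ x → ∈X x → s′ ~ x
        s′X x Xx = adj λ s′x → no-bull (~-sym os) ss′ os′ (~-sym ts) (oX x Xx) (sX Xx) ot (≁-sym ts′) s′x (tX Xx)

    module Contradiction (P : Pair) (maxX : Maximal P) (maxY : Maximal (swap P)) where
      open Centre P maxX maxY
      module C′ = Centre (swap P) maxY maxX

      Reached : V → V → Set
      Reached o = Path (λ u → ¬ Full u × o ~ u) (a P)

      -- A non-full `t` missed by `o` is anticomplete to X and Y, because `o` sees all mixed
      -- vertices. So `t` is mixed on an edge of the part already reached, and `no-exit` produces a
      -- bull there.
      full-complete : ∀ {o s} → Full o → Path (¬_ ∘ Full) (a P) s → Reached o s
      full-complete (oX , _) (start ¬fa) = start (¬fa , oX _ (a∈X P))
      full-complete {o} full@(oX , oY) (_▷_∣_ {s} {t} p st ¬ft) = reached ▷ st ∣ (¬ft , adj contra)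
        where
        reached : Reached o s
        reached = full-complete full p

        contra : o ≁ t → ⊥
        contra ot = case mixed-edge t reached (start (source reached)) (~-sym st) (tX (a∈X P)) of λ where
            (s , s′ , ps , ps′ , ss′ , ts , ts′) → exit (target ps) (target ps′) ss′ ts ts′
          where
          out-t : Outside t
          out-t = (¬true⇒false λ Xt → clash (oX _ Xt) ot) , (¬true⇒false λ Yt → clash (oY _ Yt) ot)
          tX : ∀ {x} → ∈X x → t ≁ x
          tX = unmixed-anti out-t ¬ft λ mt → clash (sees-mixed full mt) ot
          tY : ∀ {y} → ∈Y y → t ≁ y
          tY = T.unmixed-anti (proj₂ out-t , proj₁ out-t) (¬ft ∘ C′.swap-full)
                 λ mt → clash (C′.sees-mixed (swap-full full) mt) ot

          exit : ∀ {s s′} → ¬ Full s × o ~ s → ¬ Full s′ × o ~ s′ → s ~ s′ → t ~ s → t ≁ s′ → ⊥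
          exit {s} {s′} (¬fs , os) (¬fs′ , os′) ss′ ts ts′ =
            -- If `s` has a neighbour in X it has none in Y by `one-sided`, so `no-exit` applies
            -- with the sides exchanged; hence `s` may be taken anticomplete to X.
            no-exit full tX tY out-s ¬fs ¬fs′ os os′ ss′ ts ts′ ot λ Xx → nonadj λ sx →
              C′.no-exit (swap-full full) tY tX (proj₂ out-s , proj₁ out-s) (¬fs ∘ C′.swap-full) (¬fs′ ∘ C′.swap-full)
                os os′ ss′ ts ts′ ot λ Yy → nonadj λ sy → one-sided out-s ¬fs Xx sx Yy sy
            where
            out-s : Outside s
            out-s = (¬true⇒false λ Xs → clash ts (tX Xs)) , (¬true⇒false λ Ys → clash ts (tY Ys))

      no-full : ∀ {o} → ¬ Full o
      no-full {o} full = prime-component prime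
        (start (X-not-full (a∈X P)) ▷ a~c ∣ (C′.X-not-full (c∈Y P) ∘ swap-full)) (~⇒≢ a~c)
        (λ p → target p full)
        λ ¬u pa pb _ ua ub → ¬u (pa ▷ ~-sym ua ∣ λ fu → clash (proj₂ (target (full-complete fu pb))) ub)
        where
        a~c : a P ~ c P
        a~c = X~Y (a∈X P) (c∈Y P)

      module _ {t₁ t₂ t₃ : V} (triangle : Triangle t₁ t₂ t₃) where
        open Neighbourhoods prime no-bull no-house triangle

        -- N(a) is connected and contains `c` and `c′`. The vertex `s` before `c′` on a path within
        -- N(a) sees `a` and `c′`; stability keeps it out of X and Y, so by `one-sided` it would be
        -- full.
        contradiction : ⊥
        contradiction = nbrs-connected a~c a~c′ λ where
            (start _)         → co⇒≢ (c~c′ P) refl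
            (p ▷ sc′ ∣ _) → isolated (~-sym (target p)) sc′
          where
          a~c : a P ~ c P
          a~c = X~Y (a∈X P) (c∈Y P)
          a~c′ : a P ~ c′ P
          a~c′ = X~Y (a∈X P) (c′∈Y P)

          isolated : ∀ {s} → s ~ a P → s ~ c′ P → ⊥
          isolated {s} sa sc′ = one-sided
            ((¬true⇒false λ Xs → clash sa (X-stable Xs (a∈X P))) , (¬true⇒false λ Ys → clash sc′ (T.X-stable Ys (c′∈Y P))))
            no-full (a∈X P) sa (c′∈Y P) sc′

    no-C4 : ∀ {t₁ t₂ t₃} → Triangle t₁ t₂ t₃ → NoC4
    no-C4 triangle ab bc cd da ac bd a≢c b≢d = maximal-pair
      (2K2-pair (co-in a≢c ac) (co-in b≢d bd) (co-out ab) (co-out (~-sym da)) (co-out (~-sym bc)) (co-out cd))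
      λ P maxX maxY → Contradiction.contradiction P maxX maxY triangle

-- Hammer-free graphs: no 2K₂

module Hammer {V : Set} (_≟_ : DecidableEquality V) (vs : List V) (complete : ∀ v → v ∈ vs)
  (E : V → V → Bool) (E-sym : ∀ u v → E u v ≡ E v u) (E-irr : ∀ v → E v v ≡ false) where

  open Adjacency E E-sym E-irr
  open Pairs _≟_ vs complete E E-sym E-irr

  module _ (prime : Prime) (no-bull : NoBull) (no-hammer : NoHammer) where

    module Side (P : Pair) (maxX : Maximal P) (maxY : Maximal (swap P)) where

      ∈X ∈Y : V → Set
      ∈X v = X P v ≡ true
      ∈Y v = Y P v ≡ true

      Outside : V → Set
      Outside u = X P u ≡ false × Y P u ≡ false

      Full : V → Set
      Full w = (∀ x → ∈X x → w ~ x) × (∀ y → ∈Y y → w ~ y)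

      Linked : V → Set
      Linked u = Outside u × ∃ λ x → ∈X x × u ~ x

      Y-neighbour : ∀ {u} → Linked u → ¬ (∀ {y} → ∈Y y → u ~ y → ⊥)
      Y-neighbour ((Xu , Yu) , x , Xx , ux) none = maxX Xu Yu Xx ux λ y Yy → nonadj (none Yy)

      outside-or-linked : ∀ {u x} → u ~ x → ∈X x → X P u ≡ false → Linked u
      outside-or-linked {u} {x} ux Xx Xu = (Xu , ¬true⇒false λ Yu → clash ux (Y≁X P Yu Xx)) , x , Xx , ux

      -- Otherwise the triangle `u a a′` and an edge of Y on which `u` is mixed form a hammer.
      sees-all-X⇒sees-Y : ∀ {u} → Outside u → (∀ x → ∈X x → u ~ x) → ∀ y → ∈Y y → u ~ y
      sees-all-X⇒sees-Y {u} out uX y₀ Yy₀ = adj λ uy₀ →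
        Y-neighbour (out , a P , a∈X P , ua) λ Yy uy →
          case mixed-edge u (Y-connected P Yy) (Y-connected P Yy₀) uy uy₀ of λ where
            (c₁ , c₂ , p₁ , p₂ , e , uc₁ , uc₂) → no-hammer ua (uX _ (a′∈X P)) (a~a′ P) uc₁ e
              (X≁Y P (a∈X P) (target p₁)) (X≁Y P (a′∈X P) (target p₁)) uc₂
              (X≁Y P (a∈X P) (target p₂)) (X≁Y P (a′∈X P) (target p₂))
        where
        ua : u ~ a P
        ua = uX _ (a∈X P)

      X-mixed-edge : ∀ {u} → Linked u → ¬ Full u →
        ¬ (∀ {x₁ x₂} → ∈X x₁ → ∈X x₂ → x₁ ~ x₂ → u ~ x₁ → u ≁ x₂ → ⊥)
      X-mixed-edge {u} (out , x , Xx , ux) ¬full k = ¬full (uX , sees-all-X⇒sees-Y out uX)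
        where
        uX : ∀ x₀ → ∈X x₀ → u ~ x₀
        uX x₀ Xx₀ = adj λ ux₀ → case mixed-edge u (X-connected P Xx) (X-connected P Xx₀) ux ux₀ of λ where
          (_ , _ , p₁ , p₂ , e , ux₁ , ux₂) → k (target p₁) (target p₂) e ux₁ ux₂

      X-neighbour : ∀ {x} → ∈X x → ∃ λ x₀ → ∈X x₀ × x ~ x₀
      X-neighbour Xx with X-connected P Xx
      ... | start _     = a′ P , a′∈X P , a~a′ P
      ... | p ▷ e ∣ _ = _ , target p , ~-sym e

    module Linking (P : Pair) (maxX : Maximal P) (maxY : Maximal (swap P)) where
      open Side P maxX maxY public
      module S = Side (swap P) maxY maxX

      swap-full : ∀ {w} → Full w → S.Full w
      swap-full (wX , wY) = wY , wX

      swap-linked : ∀ {u} → Linked u → ¬ ¬ S.Linked u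
      swap-linked u∈@((Xu , Yu) , _) k = Y-neighbour u∈ λ {y} Yy uy → k ((Yu , Xu) , y , Yy , uy)

      Y-mixed-edge : ∀ {u} → Linked u → ¬ Full u →
        ¬ (∀ {y₁ y₂} → ∈Y y₁ → ∈Y y₂ → y₁ ~ y₂ → u ~ y₁ → u ≁ y₂ → ⊥)
      Y-mixed-edge u∈ ¬full k = swap-linked u∈ λ u∈′ → S.X-mixed-edge u∈′ (λ { (uY , uX) → ¬full (uX , uY) }) k

      -- An edge `x x′` would form a hammer with `u` and an edge of Y on which `u` is mixed.
      nbrs-stable : ∀ {u x x′} → Linked u → ¬ Full u → ∈X x → ∈X x′ → u ~ x → u ~ x′ → x ≁ x′
      nbrs-stable u∈ ¬full Xx Xx′ ux ux′ = nonadj λ e → Y-mixed-edge u∈ ¬full λ Yc₁ Yc₂ f uc₁ uc₂ →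
        no-hammer ux ux′ e uc₁ f (X≁Y P Xx Yc₁) (X≁Y P Xx′ Yc₁) uc₂ (X≁Y P Xx Yc₂) (X≁Y P Xx′ Yc₂)

      -- For an edge `x₁ x₂` of X on which `u` is mixed and a vertex `y₂` of Y missed by `u`, there
      -- would be a bull on `x₁ w x₂` with pendants `u` at `x₁` and `y₂` at `w`.
      full-sees-linked : ∀ {w u} → Full w → Linked u → ¬ Full u → w ~ u
      full-sees-linked (wX , wY) u∈ ¬full = adj λ wu →
        X-mixed-edge u∈ ¬full λ {x₁} {x₂} X₁ X₂ e ux₁ ux₂ → Y-mixed-edge u∈ ¬full λ {_} {y₂} _ Y₂ _ _ uy₂ →
          no-bull (~-sym (wX x₁ X₁)) e (wX x₂ X₂) (~-sym ux₁) (wY y₂ Y₂)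
            (X≁Y P X₁ Y₂) wu (≁-sym ux₂) (X≁Y P X₂ Y₂) uy₂

      full-sees-next : ∀ {w s t} → Full w → Linked s → ¬ Full s → w ~ s → s ~ t → w ≁ t →
        (∀ {x} → ∈X x → t ≁ x) → (∀ {y} → ∈Y y → t ≁ y) → ⊥
      full-sees-next (wX , wY) s∈@(_ , x , Xx , sx) ¬full ws st wt tX tY =
        Y-mixed-edge s∈ ¬full λ {_} {y} _ Yy _ _ sy →
          no-bull (~-sym ws) sx (wX x Xx) st (wY y Yy) sy wt (≁-sym (tX Xx)) (X≁Y P Xx Yy) (tY Yy)

    module NoFull (P : Pair) (maxX : Maximal P) (maxY : Maximal (swap P)) where
      open Linking P maxX maxY public
      module L′ = Linking (swap P) maxY maxX

      X-not-full : ∀ {x} → ∈X x → ¬ Full x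
      X-not-full Xx (xX , _) = ~⇒≢ (xX _ Xx) refl

      -- A non-full `t` missed by `w` has no neighbour in X or Y by `full-sees-linked`, so its
      -- predecessor `s` has none in X by `full-sees-next`. The triangle `w a a′` with the path
      -- `w s t` is then a hammer.
      full-complete : ∀ {w s} → Full w → Path (¬_ ∘ Full) (a P) s → w ~ s
      full-complete (wX , _) (start _) = wX _ (a∈X P)
      full-complete {w} full@(wX , wY) (_▷_∣_ {s} {t} p st ¬ft) = adj contra
        where
        ws : w ~ s
        ws = full-complete full p
        ¬fs : ¬ Full s
        ¬fs = target p

        contra : w ≁ t → ⊥
        contra wt = no-hammer (wX _ (a∈X P)) (wX _ (a′∈X P)) (a~a′ P) ws st
            (≁-sym (sX (a∈X P))) (≁-sym (sX (a′∈X P))) wt (≁-sym (tX (a∈X P))) (≁-sym (tX (a′∈X P)))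
          where
          Xt : X P t ≡ false
          Xt = ¬true⇒false λ Xt → clash (wX _ Xt) wt
          Yt : Y P t ≡ false
          Yt = ¬true⇒false λ Yt → clash (wY _ Yt) wt
          tX : ∀ {x} → ∈X x → t ≁ x
          tX Xx = nonadj λ tx → clash (full-sees-linked full (outside-or-linked tx Xx Xt) ¬ft) wt
          tY : ∀ {y} → ∈Y y → t ≁ y
          tY Yy = nonadj λ ty → clash
            (L′.full-sees-linked (swap-full full) (S.outside-or-linked ty Yy Yt) (¬ft ∘ L′.swap-full)) wt
          Xs : X P s ≡ false
          Xs = ¬true⇒false λ Xs → clash (~-sym st) (tX Xs)
          sX : ∀ {x} → ∈X x → s ≁ x
          sX Xx = nonadj λ sx → full-sees-next full (outside-or-linked sx Xx Xs) ¬fs ws st wt tX tY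

      no-full : ∀ {w} → ¬ Full w
      no-full {w} full = prime-component prime
        (start (X-not-full (a∈X P)) ▷ a~a′ P ∣ X-not-full (a′∈X P)) (~⇒≢ (a~a′ P))
        (λ p → target p full)
        λ ¬u pa pb _ ua ub → ¬u (pa ▷ ~-sym ua ∣ λ fu → clash (full-complete fu pb) ub)

      -- A neighbour `x₀` of `x` in X is missed by `u` and `u′`, whose neighbours in X are stable.
      -- If `u′` missed `y`, then `y` at `u` and `x₀` at `x` would be the pendants of a bull on
      -- `u x u′`.
      same-on-Y : ∀ {u u′ x y} → Linked u → Linked u′ → u ~ u′ → ∈X x → u ~ x → u′ ~ x →
        ∈Y y → u ~ y → u′ ~ y
      same-on-Y u∈ u′∈ uu′ Xx ux u′x Yy uy = adj λ u′y → case X-neighbour Xx of λ where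
        (x₀ , Xx₀ , xx₀) →
          let ux₀  = nonadj λ ux₀ → clash xx₀ (nbrs-stable u∈ no-full Xx Xx₀ ux ux₀)
              u′x₀ = nonadj λ u′x₀ → clash xx₀ (nbrs-stable u′∈ no-full Xx Xx₀ u′x u′x₀)
          in no-bull ux uu′ (~-sym u′x) uy xx₀ ux₀ (X≁Y P Xx Yy) u′y u′x₀ (Y≁X P Yy Xx₀)

    module Classes (P : Pair) (maxX : Maximal P) (maxY : Maximal (swap P)) where
      open NoFull P maxX maxY public
      module N′ = NoFull (swap P) maxY maxX

      _⊑_ : V → V → Set
      u ⊑ u′ = (∀ {x} → ∈X x → u ~ x → u′ ~ x) × (∀ {y} → ∈Y y → u ~ y → u′ ~ y)

      -- A common neighbour in X transfers neighbours in Y; the common neighbour in Y so obtained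
      -- transfers those in X.
      shared⇒⊑ : ∀ {u u′ x} → Linked u → Linked u′ → u ~ u′ → ∈X x → u ~ x → u′ ~ x → u ⊑ u′
      shared⇒⊑ u∈ u′∈ uu′ Xx ux u′x =
        (λ Xx₁ ux₁ → adj λ u′x₁ → Y-neighbour u∈ λ Yy uy →
          swap-linked u∈ λ u∈ˢ → swap-linked u′∈ λ u′∈ˢ →
            clash (N′.same-on-Y u∈ˢ u′∈ˢ uu′ Yy uy (same-on-Y u∈ u′∈ uu′ Xx ux u′x Yy uy) Xx₁ ux₁) u′x₁)
        , same-on-Y u∈ u′∈ uu′ Xx ux u′x

      shared⇒⊑′ : ∀ {u u′ y} → Linked u → Linked u′ → u ~ u′ → ∈Y y → u ~ y → u′ ~ y → ¬ ¬ (u ⊑ u′)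
      shared⇒⊑′ u∈ u′∈@(_ , x′ , Xx′ , u′x′) uu′ Yy uy u′y k = swap-linked u∈ λ u∈ˢ → swap-linked u′∈ λ u′∈ˢ →
        k ((λ Xx ux → N′.same-on-Y u∈ˢ u′∈ˢ uu′ Yy uy u′y Xx ux)
          , λ Yy₁ uy₁ → same-on-Y u∈ u′∈ uu′ Xx′ (N′.same-on-Y u′∈ˢ u∈ˢ (~-sym uu′) Yy u′y uy Xx′ u′x′) u′x′ Yy₁ uy₁)

      -- Otherwise the component of u among the vertices with the same
      -- neighbours as u in X ∪ Y would be homogeneous.
      no-shared-X : ∀ {u u′ x} → Linked u → Linked u′ → u ~ u′ → ∈X x → u ~ x → u′ ~ x → ⊥
      no-shared-X {u} {u′} {x} u∈ u′∈ uu′ Xx ux u′x =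
        prime-component prime (start (u∈ , refl-⊑ , refl-⊑) ▷ uu′ ∣
            (u′∈ , shared⇒⊑ u∈ u′∈ uu′ Xx ux u′x , shared⇒⊑ u′∈ u∈ (~-sym uu′) Xx u′x ux))
          (~⇒≢ uu′) (λ p → true≢false Xx (proj₁ (proj₁ (proj₁ (target p)))))
          λ ¬t pp pq pq~ tp tq → separates ¬t pp (target pp) (target pq) pq~ tp tq
        where
        refl-⊑ : ∀ {u} → u ⊑ u
        refl-⊑ = (λ _ e → e) , (λ _ e → e)

        Same : V → Set
        Same t = Linked t × u ⊑ t × t ⊑ u

        separates : ∀ {t p q} → ¬ Path Same u t → Path Same u p → Same p → Same q → p ~ q → t ~ p → t ≁ q → ⊥
        separates {t} {p} {q} ¬t path (p∈ , u⊑p , p⊑u) (q∈ , u⊑q , q⊑u) pq tp tq =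
          -- Either `t` has the same neighbours in X ∪ Y as `p` and joins the component, or `t`
          -- together with `x₀` or `y` completes a bull or a hammer on the triangle `p q x`.
          by-adjacency t x
            (λ tx → joins (outside-or-linked tx Xx Xt) λ t∈ k →
              k (shared⇒⊑ t∈ p∈ tp Xx tx px) (shared⇒⊑ p∈ t∈ (~-sym tp) Xx px tx))
            (λ tx → case X-neighbour Xx of λ where
              (x₀ , Xx₀ , xx₀) →
                let px₀ = nonadj λ px₀ → clash xx₀ (nbrs-stable p∈ no-full Xx Xx₀ px px₀)
                    qx₀ = nonadj λ qx₀ → clash xx₀ (nbrs-stable q∈ no-full Xx Xx₀ qx qx₀)
                in by-adjacency t x₀
                     (λ tx₀ → let t∈ = outside-or-linked tx₀ Xx₀ Xt in
                       Y-neighbour t∈ λ {y} Yy ty → by-adjacency p y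
                         (λ py → joins t∈ λ t∈ k → shared⇒⊑′ t∈ p∈ tp Yy ty py λ t⊑p →
                           shared⇒⊑′ p∈ t∈ (~-sym tp) Yy py ty λ p⊑t → k t⊑p p⊑t)
                         (λ py → let qy = nonadj {q} {y} λ qy → clash (proj₂ u⊑p Yy (proj₂ q⊑u Yy qy)) py in
                           no-hammer pq px qx (~-sym tp) ty (≁-sym tq) (≁-sym tx) py qy (X≁Y P Xx Yy)))
                     (λ tx₀ → no-bull px pq (~-sym qx) (~-sym tp) xx₀ px₀ (≁-sym tx) (≁-sym tq) qx₀ tx₀))
          where
          px : p ~ x
          px = proj₁ u⊑p Xx ux
          qx : q ~ x
          qx = proj₁ u⊑q Xx ux
          Xt : X P t ≡ false
          Xt = ¬true⇒false λ Xt → clash (~-sym (proj₁ u⊑q Xt (proj₁ p⊑u Xt (~-sym tp)))) tq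
          joins : Linked t → (Linked t → (t ⊑ p → p ⊑ t → ⊥) → ⊥) → ⊥
          joins t∈ h = h t∈ λ t⊑p p⊑t → ¬t (path ▷ ~-sym tp ∣ (t∈ ,
            ((λ Xz uz → proj₁ p⊑t Xz (proj₁ u⊑p Xz uz)) , (λ Yz uz → proj₂ p⊑t Yz (proj₂ u⊑p Yz uz))) ,
            ((λ Xz tz → proj₁ p⊑u Xz (proj₁ t⊑p Xz tz)) , (λ Yz tz → proj₂ p⊑u Yz (proj₂ t⊑p Yz tz)))))

    module Triangles (P : Pair) (maxX : Maximal P) (maxY : Maximal (swap P)) where
      open Classes P maxX maxY public
      module K′ = Classes (swap P) maxY maxX

      no-shared-Y : ∀ {u u′ y} → Linked u → Linked u′ → u ~ u′ → ∈Y y → u ~ y → u′ ~ y → ⊥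
      no-shared-Y u∈ u′∈ uu′ Yy uy u′y = swap-linked u∈ λ u∈ˢ → swap-linked u′∈ λ u′∈ˢ →
        K′.no-shared-X u∈ˢ u′∈ˢ uu′ Yy uy u′y

      -- Adjacent linked vertices share no neighbour in X or Y, so a neighbour of `u` in X and one
      -- of `u′` in Y are the pendants of a bull on `u u′ t`.
      no-triangle₂ : ∀ {u u′ t} → Linked u → Linked u′ → u ~ u′ → t ~ u → t ~ u′ → ⊥
      no-triangle₂ {u} {u′} {t} u∈@(_ , x , Xx , ux) u′∈ uu′ tu tu′ = Y-neighbour u′∈ λ {y} Yy u′y →
        let tx = nonadj {t} {x} λ tx → no-shared-X (outside-or-linked tx Xx Xt) u∈ tu Xx tx ux
            ty = nonadj {t} {y} λ ty → K′.swap-linked ((Yt , Xt) , y , Yy , ty) λ t∈ →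
                   no-shared-Y t∈ u′∈ tu′ Yy ty u′y
            u′x = nonadj {u′} {x} λ u′x → no-shared-X u∈ u′∈ uu′ Xx ux u′x
            uy = nonadj {u} {y} λ uy → no-shared-Y u∈ u′∈ uu′ Yy uy u′y
        in no-bull uu′ (~-sym tu) (~-sym tu′) ux u′y uy u′x tx ty (X≁Y P Xx Yy)
        where
        Xt : X P t ≡ false
        Xt = ¬true⇒false λ Xt → no-shared-X u∈ u′∈ uu′ Xt (~-sym tu) (~-sym tu′)
        Yt : Y P t ≡ false
        Yt = ¬true⇒false λ Yt → no-shared-Y u∈ u′∈ uu′ Yt (~-sym tu) (~-sym tu′)

      no-triangle-X : ∀ {u b c} → Linked u → Triangle u b c → ∈X b → ⊥
      no-triangle-X u∈ (ub , uc , bc) Xb = no-triangle₂ u∈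
        (outside-or-linked (~-sym bc) Xb (¬true⇒false λ Xc → clash bc (nbrs-stable u∈ no-full Xb Xc ub uc)))
        uc (~-sym ub) bc

    module NoTriangle (P : Pair) (maxX : Maximal P) (maxY : Maximal (swap P)) where
      open Triangles P maxX maxY public

      anti-X : ∀ {u b c x} → Linked u → Triangle u b c → ∈X x → b ≁ x
      anti-X u∈ tri@(ub , uc , bc) Xx = nonadj λ bx →
        no-triangle₂ u∈ (outside-or-linked bx Xx (¬true⇒false (no-triangle-X u∈ tri))) ub (~-sym uc) (~-sym bc)

      -- By `anti-X` the vertices `b` and `c` have no neighbour in X, so an edge of X on which `u`
      -- is mixed extends the triangle to a hammer.
      no-triangle : ∀ {u b c} → Linked u → Triangle u b c → ⊥
      no-triangle u∈ tri@(ub , uc , bc) = X-mixed-edge u∈ no-full λ X₁ X₂ e ux₁ ux₂ →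
        no-hammer ub uc bc ux₁ e (anti-X u∈ tri X₁) (anti-X u∈ tri′ X₁) ux₂ (anti-X u∈ tri X₂) (anti-X u∈ tri′ X₂)
        where
        tri′ : Triangle _ _ _
        tri′ = uc , ub , ~-sym bc

      Near : V → Set
      Near r = ∃ λ p → ∃ λ q → ∃ λ s → Triangle p q s × p ~ r

      -- If `r` sees a second vertex of the triangle, it lies in a triangle itself. Otherwise `r r′`
      -- would complete a hammer unless `r′` sees the triangle too.
      near-next : ∀ {r r′} → Near r → r ~ r′ → ¬ ¬ Near r′
      near-next {r} {r′} (p , q , s , (pq , ps , qs) , pr) rr′ k = by-adjacency r q
        (λ rq → k (r , p , q , (~-sym pr , rq , pq) , rr′))
        (λ rq → by-adjacency r s
          (λ rs → k (r , p , s , (~-sym pr , rs , ps) , rr′))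
          (λ rs → by-adjacency p r′
            (λ pr′ → k (p , q , s , (pq , ps , qs) , pr′))
            (λ pr′ → by-adjacency q r′
              (λ qr′ → k (q , p , s , (~-sym pq , qs , ps) , qr′))
              (λ qr′ → by-adjacency s r′
                (λ sr′ → k (s , p , q , (~-sym ps , ~-sym qs , pq) , sr′))
                (λ sr′ → no-hammer pq ps qs pr rr′ (≁-sym rq) (≁-sym rs) pr′ qr′ sr′)))))

      -- A linked vertex lies in no triangle. Hence `u` misses `q` and `s`, and a vertex of the
      -- triangle outside X cannot see `x`, or it would be linked. If all three were outside X,
      -- `p q s u x` would be a hammer.
      touches : ∀ {u p q s} → Linked u → Triangle p q s → p ~ u →
        ¬ ((∈X p → ⊥) × (∈X q → ⊥) × (∈X s → ⊥))
      touches {u} {p} {q} {s} u∈@(_ , x , Xx , ux) tri@(pq , ps , qs) pu (¬p , ¬q , ¬s) =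
        no-hammer pq ps qs pu ux
          (nonadj λ qu → no-triangle u∈ (~-sym pu , ~-sym qu , pq)) (nonadj λ su → no-triangle u∈ (~-sym pu , ~-sym su , ps))
          (avoids tri ¬p) (avoids (~-sym pq , qs , ps) ¬q) (avoids (~-sym ps , ~-sym qs , pq) ¬s)
        where
        avoids : ∀ {m b c} → Triangle m b c → ¬ ∈X m → m ≁ x
        avoids tri ¬m = nonadj λ mx → no-triangle (outside-or-linked mx Xx (¬true⇒false ¬m)) tri

    module Contradiction (P : Pair) (maxX : Maximal P) (maxY : Maximal (swap P)) where
      open NoTriangle P maxX maxY
      module M′ = NoTriangle (swap P) maxY maxX

      module _ {t₁ t₂ t₃ : V} (triangle : Triangle t₁ t₂ t₃) where

        near : ∀ {r} → Path (λ _ → ⊤) t₁ r → ¬ ¬ Near r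
        near (start _) k   = let (e , f , g) = triangle in k (t₂ , t₁ , t₃ , (~-sym e , g , f) , ~-sym e)
        near (p ▷ e ∣ _) k = near p λ n → near-next n e k

        -- Primality of X gives a linked vertex, and by connectivity it has a neighbour in some
        -- triangle. That triangle would have to meet both X and Y, which are disjoint and
        -- anticomplete.
        contradiction : ⊥
        contradiction = prime ∈X (a∈X P) (a′∈X P) (~⇒≢ (a~a′ P)) (λ Xc → disjoint P Xc (c∈Y P)) λ u ¬Xu Xa _ ua _ →
            connected prime (proj₁ triangle) u λ path → near path λ where
              (p , q , s , tri , pu) → meets (outside-or-linked ua Xa (¬true⇒false ¬Xu)) tri pu
          where
          meets : ∀ {u p q s} → Linked u → Triangle p q s → p ~ u → ⊥
          meets u∈ tri@(pq , ps , qs) pu = touches u∈ tri pu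
            ( meetsY (disjoint P) (λ Xp Yq → clash pq (X≁Y P Xp Yq)) (λ Xp Ys → clash ps (X≁Y P Xp Ys))
            , meetsY (λ Xq Yp → clash pq (Y≁X P Yp Xq)) (disjoint P) (λ Xq Ys → clash qs (X≁Y P Xq Ys))
            , meetsY (λ Xs Yp → clash ps (Y≁X P Yp Xs)) (λ Xs Yq → clash qs (Y≁X P Yq Xs)) (disjoint P))
            where
            meetsY : ∀ {m} → (∈X m → ∈Y _ → ⊥) → (∈X m → ∈Y _ → ⊥) → (∈X m → ∈Y _ → ⊥) → ∈X m → ⊥
            meetsY f g h Xm = swap-linked u∈ λ u∈ˢ → M′.touches u∈ˢ tri pu (f Xm , g Xm , h Xm)

    no-2K2 : ∀ {t₁ t₂ t₃} → Triangle t₁ t₂ t₃ → No2K2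
    no-2K2 triangle pq rs pr ps qr qs = maximal-pair (2K2-pair pq rs pr ps qr qs)
      λ P maxX maxY → Contradiction.contradiction P maxX maxY triangle

-- Diamond-free graphs: a vertex whose non-neighbours form a clique

module Diamond {V : Set} (_≟_ : DecidableEquality V)
  (E : V → V → Bool) (E-sym : ∀ u v → E u v ≡ E v u) (E-irr : ∀ v → E v v ≡ false) where

  open Adjacency E E-sym E-irr

  CoClique : V → Set
  CoClique v = ∀ {m m′} → m ≢ v → v ≁ m → m′ ≢ v → v ≁ m′ → m ≢ m′ → m ~ m′

  module _ (prime : Prime) (no-bull : NoBull) (no-diamond : NoDiamond)
    (no-simplicial : ∀ v → ¬ Simplicial v) {v a b : V} (triangle : Triangle v a b) where

    va : v ~ a
    va = proj₁ triangle

    common : ∀ {x y u w} → x ~ y → u ~ x → u ~ y → w ~ x → w ~ y → u ≢ w → u ~ w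
    common xy ux uy wx wy u≢w = adj λ uw →
      no-diamond xy (~-sym ux) (~-sym wx) (~-sym uy) (~-sym wy) uw u≢w

    -- The maximal clique through the edge va.
    K : V → Set
    K u = u ≡ v ⊎ u ≡ a ⊎ (u ~ v × u ~ a)

    K-clique : ∀ {u w} → K u → K w → u ≢ w → u ~ w
    K-clique (inj₁ refl)               (inj₁ refl)               u≢w = ⊥-elim (u≢w refl)
    K-clique (inj₁ refl)               (inj₂ (inj₁ refl))        u≢w = va
    K-clique (inj₁ refl)               (inj₂ (inj₂ (wv , _)))    u≢w = ~-sym wv
    K-clique (inj₂ (inj₁ refl))        (inj₁ refl)               u≢w = ~-sym va
    K-clique (inj₂ (inj₁ refl))        (inj₂ (inj₁ refl))        u≢w = ⊥-elim (u≢w refl)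
    K-clique (inj₂ (inj₁ refl))        (inj₂ (inj₂ (_ , wa)))    u≢w = ~-sym wa
    K-clique (inj₂ (inj₂ (uv , _)))    (inj₁ refl)               u≢w = uv
    K-clique (inj₂ (inj₂ (_ , ua)))    (inj₂ (inj₁ refl))        u≢w = ua
    K-clique (inj₂ (inj₂ (uv , ua)))   (inj₂ (inj₂ (wv , wa)))   u≢w = common va uv ua wv wa u≢w

    v∈K : K v
    v∈K = inj₁ refl
    a∈K : K a
    a∈K = inj₂ (inj₁ refl)
    b∈K : K b
    b∈K = inj₂ (inj₂ (~-sym (proj₁ (proj₂ triangle)) , ~-sym (proj₂ (proj₂ triangle))))

    K-closed : ∀ {u k k′} → K k → K k′ → k ≢ k′ → u ~ k → u ~ k′ → K u
    K-closed {u} {k} {k′} Kk Kk′ k≢k′ uk uk′ with u ≟ v | u ≟ a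
    ... | yes e | _     = inj₁ e
    ... | no _  | yes e = inj₂ (inj₁ e)
    ... | no u≢v | no u≢a = inj₂ (inj₂ (sees v∈K u≢v , sees a∈K u≢a))
      where
      sees : ∀ {z} → K z → u ≢ z → u ~ z
      sees {z} Kz u≢z with z ≟ k | z ≟ k′
      ... | yes refl | _ = uk
      ... | no _ | yes refl = uk′
      ... | no z≢k | no z≢k′ =
        common (K-clique Kk Kk′ k≢k′) uk uk′ (K-clique Kz Kk z≢k) (K-clique Kz Kk′ z≢k′) u≢z

    third : ∀ k k′ → ∃ λ k″ → K k″ × k″ ≢ k × k″ ≢ k′
    third k k′ with v ≟ k | v ≟ k′ | a ≟ k | a ≟ k′
    ... | no p | no q | _ | _ = v , v∈K , p , q
    ... | _ | _ | no p | no q = a , a∈K , p , q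
    ... | yes refl | _ | yes refl | _ = ⊥-elim (~⇒≢ va refl)
    ... | yes refl | _ | no _ | yes refl = b , b∈K , ≢-sym (~⇒≢ (proj₁ (proj₂ triangle))) , ≢-sym (~⇒≢ (proj₂ (proj₂ triangle)))
    ... | no _ | yes refl | yes refl | _ = b , b∈K , ≢-sym (~⇒≢ (proj₂ (proj₂ triangle))) , ≢-sym (~⇒≢ (proj₁ (proj₂ triangle)))
    ... | no _ | yes refl | no _ | yes refl = ⊥-elim (~⇒≢ va refl)

    outside-nbr : ∀ {k} → K k → ¬ (∀ {u} → ¬ K u → u ~ k → ⊥)
    outside-nbr {k} Kk none = no-simplicial k λ kp kq p≢q → adj λ pq →
      none (λ Kp → none (λ Kq → clash (K-clique Kp Kq p≢q) pq) (~-sym kq)) (~-sym kp)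

    only-nbr : ∀ {u k k′} → ¬ K u → K k → K k′ → k ≢ k′ → u ~ k → u ≁ k′
    only-nbr ¬Ku Kk Kk′ k≢k′ uk = nonadj λ uk′ → ¬Ku (K-closed Kk Kk′ k≢k′ uk uk′)

    -- Otherwise `u` and `u′` are the pendants of a bull on `k`, `k′` and a third vertex of K.
    outside-adjacent : ∀ {u u′ k k′} → ¬ K u → ¬ K u′ → K k → K k′ → k ≢ k′ → u ~ k → u′ ~ k′ → u ~ u′
    outside-adjacent {k = k} {k′} ¬Ku ¬Ku′ Kk Kk′ k≢k′ uk u′k′ = adj λ uu′ → case third k k′ of λ where
      (k″ , Kk″ , k″≢k , k″≢k′) → no-bull
        (K-clique Kk Kk′ k≢k′) (K-clique Kk Kk″ (≢-sym k″≢k)) (K-clique Kk′ Kk″ (≢-sym k″≢k′)) (~-sym uk) (~-sym u′k′)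
        (≁-sym (only-nbr ¬Ku′ Kk′ Kk (≢-sym k≢k′) u′k′)) (≁-sym (only-nbr ¬Ku Kk Kk′ k≢k′ uk))
        (≁-sym (only-nbr ¬Ku Kk Kk″ (≢-sym k″≢k) uk)) (≁-sym (only-nbr ¬Ku′ Kk′ Kk″ (≢-sym k″≢k′) u′k′)) uu′

    -- Outside neighbours `u₂`, `u₃` of two further vertices of K are adjacent to each other and to
    -- `u` and `w`. Diamond-freeness at `u₂ u₃` gives `u ~ w`, and at `u w` it gives `k ~ u₂`,
    -- although `u₂` sees only `k₂` in K.
    outside-unique : ∀ {u w k} → ¬ K u → ¬ K w → K k → u ~ k → w ~ k → u ≢ w → ⊥
    outside-unique {k = k} ¬Ku ¬Kw Kk uk wk u≢w =
      case third k k of λ where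
        (k₂ , Kk₂ , k₂≢k , _) → case third k k₂ of λ where
          (k₃ , Kk₃ , k₃≢k , k₃≢k₂) → outside-nbr Kk₂ λ {u₂} ¬Ku₂ u₂k₂ → outside-nbr Kk₃ λ ¬Ku₃ u₃k₃ →
            let uu₂ = outside-adjacent ¬Ku ¬Ku₂ Kk Kk₂ (≢-sym k₂≢k) uk u₂k₂
                wu₂ = outside-adjacent ¬Kw ¬Ku₂ Kk Kk₂ (≢-sym k₂≢k) wk u₂k₂
                uu₃ = outside-adjacent ¬Ku ¬Ku₃ Kk Kk₃ (≢-sym k₃≢k) uk u₃k₃
                wu₃ = outside-adjacent ¬Kw ¬Ku₃ Kk Kk₃ (≢-sym k₃≢k) wk u₃k₃
                u₂u₃ = outside-adjacent ¬Ku₂ ¬Ku₃ Kk₂ Kk₃ (≢-sym k₃≢k₂) u₂k₂ u₃k₃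
                uw = common u₂u₃ uu₂ uu₃ wu₂ wu₃ u≢w
            in clash (common uw (~-sym uk) (~-sym wk) (~-sym uu₂) (~-sym wu₂) λ { refl → ¬Ku₂ Kk })
                 (≁-sym (only-nbr ¬Ku₂ Kk₂ Kk k₂≢k u₂k₂))

    L : V → Set
    L u = ¬ K u × ∃ λ k → K k × u ~ k

    L-clique : ∀ {u w} → L u → L w → u ≢ w → u ~ w
    L-clique (¬Ku , k , Kk , uk) (¬Kw , k′ , Kk′ , wk′) u≢w with k ≟ k′
    ... | yes refl = ⊥-elim (outside-unique ¬Ku ¬Kw Kk uk wk′ u≢w)
    ... | no k≢k′  = outside-adjacent ¬Ku ¬Kw Kk Kk′ k≢k′ uk wk′

    W : V → Set
    W w = ¬ K w × ¬ L w × ∃ λ u → L u × w ~ u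

    -- Suppose `w` sees `u₀` but not `u`, and let `u₃` be the outside neighbour of a third vertex of
    -- K. If `w ~ u₃`, the edge `u₀ u₃` forces `w ~ u`; if not, `w` and `k` are the pendants of a
    -- bull on `u₀ u u₃`.
    W-complete : ∀ {w u} → W w → L u → w ~ u
    W-complete {w} {u} (¬Kw , ¬Lw , u₀ , Lu₀@(¬Ku₀ , k₀ , Kk₀ , u₀k₀) , wu₀) Lu@(¬Ku , k , Kk , uk) = adj λ wu →
      let u₀≢u = λ { refl → clash wu₀ wu }
          k₀≢k = λ { refl → outside-unique ¬Ku₀ ¬Ku Kk₀ u₀k₀ uk u₀≢u }
      in case third k₀ k of λ where
        (k₃ , Kk₃ , k₃≢k₀ , k₃≢k) → outside-nbr Kk₃ λ {u₃} ¬Ku₃ u₃k₃ →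
          let u₀u₃ = outside-adjacent ¬Ku₀ ¬Ku₃ Kk₀ Kk₃ (≢-sym k₃≢k₀) u₀k₀ u₃k₃
              uu₃  = outside-adjacent ¬Ku ¬Ku₃ Kk Kk₃ (≢-sym k₃≢k) uk u₃k₃
              u₀u  = L-clique Lu₀ Lu u₀≢u
          in by-adjacency w u₃
               (λ wu₃ → clash (common u₀u₃ wu₀ wu₃ (~-sym u₀u) uu₃ λ { refl → ¬Lw Lu }) wu)
               (λ wu₃ → no-bull u₀u u₀u₃ uu₃ (~-sym wu₀) uk
                 (only-nbr ¬Ku₀ Kk₀ Kk k₀≢k u₀k₀) (≁-sym wu) (≁-sym wu₃) (only-nbr ¬Ku₃ Kk₃ Kk k₃≢k u₃k₃)
                 (nonadj λ wk → ¬Lw (¬Kw , k , Kk , wk)))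

    two-L : ¬ (∀ {u u′} → L u → L u′ → u ~ u′ → u ~ v → u′ ≁ v → ⊥)
    two-L k = outside-nbr v∈K λ ¬Ku uv → outside-nbr a∈K λ ¬Ku′ u′a →
      k (¬Ku , v , v∈K , uv) (¬Ku′ , a , a∈K , u′a) (outside-adjacent ¬Ku ¬Ku′ v∈K a∈K (~⇒≢ va) uv u′a) uv
        (only-nbr ¬Ku′ a∈K v∈K (≢-sym (~⇒≢ va)) u′a)

    W-clique : ∀ {w w′} → W w → W w′ → w ≢ w′ → w ~ w′
    W-clique Ww Ww′ w≢w′ = adj λ ww′ → two-L λ Lu Lu′ uu′ _ _ →
      clash (common uu′ (W-complete Ww Lu) (W-complete Ww Lu′) (W-complete Ww′ Lu) (W-complete Ww′ Lu′) w≢w′) ww′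

    -- K, L and W exhaust the graph: a first vertex `z` beyond `y` in W would be a pendant at `y`,
    -- with `v` the other pendant, of a bull on `y` and two vertices of L.
    covered : ∀ {z} → Path (λ _ → ⊤) v z → ¬ (¬ K z × ¬ L z × ¬ W z)
    covered (start _) (¬Kv , _) = ¬Kv v∈K
    covered (_▷_∣_ {y} {z} p yz _) (¬Kz , ¬Lz , ¬Wz) = covered p (¬Ky , ¬Ly , ¬Wy)
      where
      ¬Ky : ¬ K y
      ¬Ky Ky = ¬Lz (¬Kz , y , Ky , ~-sym yz)
      ¬Ly : ¬ L y
      ¬Ly Ly = ¬Wz (¬Kz , ¬Lz , y , Ly , ~-sym yz)
      z≁L : ∀ {u} → L u → u ≁ z
      z≁L Lu = nonadj λ uz → ¬Wz (¬Kz , ¬Lz , _ , Lu , ~-sym uz)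
      ¬Wy : ¬ W y
      ¬Wy Wy = two-L λ Lu Lu′ uu′ uv u′v → no-bull
        (W-complete Wy Lu) (W-complete Wy Lu′) uu′ yz uv
        (nonadj λ yv → ¬Ly (¬Ky , v , v∈K , yv)) (z≁L Lu) (z≁L Lu′) u′v
        (nonadj λ zv → ¬Lz (¬Kz , v , v∈K , zv))

    coclique : CoClique v
    coclique {m} {m′} m≢v vm m′≢v vm′ m≢m′ = adj λ mm′ →
      connected prime va m λ p → connected prime va m′ λ p′ →
        let none : ∀ {m} → m ≢ v → v ≁ m → ¬ K m
            none m≢v vm Km = clash (K-clique v∈K Km (≢-sym m≢v)) vm
        in covered p
          ( none m≢v vm
          , (λ Lm → covered p′ (none m′≢v vm′ , (λ Lm′ → clash (L-clique Lm Lm′ m≢m′) mm′)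
                               , (λ Wm′ → clash (~-sym (W-complete Wm′ Lm)) mm′)))
          , (λ Wm → covered p′ (none m′≢v vm′ , (λ Lm′ → clash (W-complete Wm Lm′) mm′)
                               , (λ Wm′ → clash (W-clique Wm Wm′ m≢m′) mm′))))

-- Weighted cliques and multicolourings

member-pairs : ∀ {A : Set} {R : A → A → Set} → (∀ {x y} → R x y → R y x) →
  ∀ {xs x y} → AllPairs R xs → x ∈ xs → y ∈ xs → x ≢ y → R x y
member-pairs R-sym (p ∷ ps) (here refl) (here refl) x≢y = ⊥-elim (x≢y refl)
member-pairs R-sym (p ∷ ps) (here refl) (there j)   x≢y = All.lookup p j
member-pairs R-sym (p ∷ ps) (there i)   (here refl) x≢y = R-sym (All.lookup p i)
member-pairs R-sym (p ∷ ps) (there i)   (there j)   x≢y = member-pairs R-sym ps i j x≢y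

≡-≤-trans : ∀ {i j k} → i ≡ j → j ≤ k → i ≤ k
≡-≤-trans refl h = h

module Weights {V : Set} (_≟_ : DecidableEquality V) (vs : List V) (complete : ∀ v → v ∈ vs)
  (E : V → V → Bool) (E-sym : ∀ u v → E u v ≡ E v u) (E-irr : ∀ v → E v v ≡ false) where

  open Adjacency E E-sym E-irr

  Clique : List V → Set
  Clique = AllPairs _~_

  In Out : (V → Bool) → V → Set
  In A v  = A v ≡ true
  Out A v = A v ≡ false

  wt : (V → ℕ) → List V → ℕ
  wt w Q = sum (map w Q)

  wt-++ : ∀ w Q R → wt w (Q ++ R) ≡ wt w Q + wt w R
  wt-++ w Q R = trans (cong sum (map-++ w Q R)) (sum-++ (map w Q) (map w R))

  wt-≡ : ∀ {w w′ Q} → All (λ v → w v ≡ w′ v) Q → wt w Q ≡ wt w′ Q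
  wt-≡ []       = refl
  wt-≡ (e ∷ es) rewrite e | wt-≡ es = refl

  module _ (A : V → Bool) where

    inside outside : List V → List V
    inside  = filter (λ v → A v Bool.≟ true)
    outside = filter (λ v → A v Bool.≟ false)

    wt-split : ∀ w Q → wt w Q ≡ wt w (inside Q) + wt w (outside Q)
    wt-split w []      = refl
    wt-split w (v ∷ Q) with A v
    ... | true  = trans (cong (w v +_) (wt-split w Q)) (sym (ℕₚ.+-assoc (w v) _ _))
    ... | false = trans (cong (w v +_) (wt-split w Q)) (x∙yz≈y∙xz (w v) (wt w (inside Q)) (wt w (outside Q)))

    inside-In : ∀ Q → All (In A) (inside Q)
    inside-In = Allₚ.all-filter _

    outside-Out : ∀ Q → All (Out A) (outside Q)
    outside-Out = Allₚ.all-filter _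

    inside-All : ∀ {P : V → Set} {Q} → All P Q → All P (inside Q)
    inside-All = Allₚ.filter⁺ _

    outside-All : ∀ {P : V → Set} {Q} → All P Q → All P (outside Q)
    outside-All = Allₚ.filter⁺ _

    inside-clique : ∀ {Q} → Clique Q → Clique (inside Q)
    inside-clique = AllPairsₚ.filter⁺ _

    outside-clique : ∀ {Q} → Clique Q → Clique (outside Q)
    outside-clique = AllPairsₚ.filter⁺ _

    cross-adjacent : ∀ {Q} → Clique Q → All (λ x → All (x ~_) (outside Q)) (inside Q)
    cross-adjacent {Q} cl = All.map (λ (Ax , x∈) → All.map (λ (Ay , y∈) →
        member-pairs ~-sym cl x∈ y∈ λ { refl → true≢false Ax Ay })
        (All.zip (outside-Out Q , outside-All members))) (All.zip (inside-In Q , inside-All members))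
      where
      members : All (_∈ Q) Q
      members = All.tabulate id

  constant-clique : ∀ {x Q} → Clique Q → All (_≡ x) Q → Q ≡ [] ⊎ Q ≡ x ∷ []
  constant-clique []  []                   = inj₁ refl
  constant-clique (_ ∷ []) (refl ∷ [])     = inj₂ refl
  constant-clique ((e ∷ _) ∷ _) (refl ∷ refl ∷ _) = ⊥-elim (~⇒≢ e refl)

  record MaxClique (w : V → ℕ) (A : V → Bool) (us : List V) : Set where
    field
      Q       : List V
      clique  : Clique Q
      within  : All (In A) Q
      maximum : ∀ {R} → Clique R → All (In A) R → All (_∈ us) R → wt w R ≤ wt w Q

  -- Branching on `x`: a clique either omits `x` or consists of `x` and a clique among its
  -- neighbours.
  max-clique-among : ∀ w A us → MaxClique w A us
  max-clique-among w A [] = record { Q = [] ; clique = [] ; within = [] ; maximum = λ { {[]} _ _ _ → z≤n ; {_ ∷ _} _ _ (() ∷ _) } }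
  max-clique-among w A (x ∷ us) with A x in Ax
  ... | false = record { MaxClique rec ; maximum = λ cl AR R⊆ → MaxClique.maximum rec cl AR (All.map skip (All.zip (AR , R⊆))) }
    where
    rec : MaxClique w A us
    rec = max-clique-among w A us
    skip : ∀ {v} → In A v × v ∈ x ∷ us → v ∈ us
    skip (Av , here refl) = ⊥-elim (true≢false Av Ax)
    skip (_  , there i)   = i
  ... | true = choose (wt w (MaxClique.Q with-x) + w x ≤? wt w (MaxClique.Q without-x))
    where
    A∩Nx : V → Bool
    A∩Nx v = A v ∧ E x v
    without-x : MaxClique w A us
    without-x = max-clique-among w A us
    with-x : MaxClique w A∩Nx us
    with-x = max-clique-among w A∩Nx us
    isx : V → Bool
    isx v = ⌊ v ≟ x ⌋

    drop-x : ∀ {v} → Out isx v × v ∈ x ∷ us → v ∈ us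
    drop-x (ne , here refl) = ⊥-elim (true≢false (≟-true _≟_ refl) ne)
    drop-x (_  , there i)   = i

    bound : ∀ {R} → Clique R → All (In A) R → All (_∈ x ∷ us) R →
      wt w R ≤ wt w (MaxClique.Q without-x) ⊎ wt w R ≤ wt w (MaxClique.Q with-x) + w x
    bound {R} cl AR R⊆ = go _ refl (constant-clique (inside-clique isx cl) (All.map (≟-sound _≟_) (inside-In isx R)))
      where
      S⊆ : All (_∈ us) (outside isx R)
      S⊆ = All.map drop-x (All.zip (outside-Out isx R , outside-All isx R⊆))
      go : ∀ I → inside isx R ≡ I → I ≡ [] ⊎ I ≡ x ∷ [] →
        wt w R ≤ wt w (MaxClique.Q without-x) ⊎ wt w R ≤ wt w (MaxClique.Q with-x) + w x
      go _ e (inj₁ refl) = inj₁ (≡-≤-trans (trans (wt-split isx w R) (cong (λ I → wt w I + wt w (outside isx R)) e))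
        (MaxClique.maximum without-x (outside-clique isx cl) (outside-All isx AR) S⊆))
      go _ e (inj₂ refl) = inj₂ (≡-≤-trans
        (trans (wt-split isx w R) (trans (cong (λ I → wt w I + wt w (outside isx R)) e)
          (trans (cong (_+ wt w (outside isx R)) (ℕₚ.+-identityʳ (w x))) (ℕₚ.+-comm (w x) _))))
        (ℕₚ.+-monoˡ-≤ (w x) (MaxClique.maximum with-x (outside-clique isx cl)
          (All.map (λ (Av , xv) → ∧-in Av xv) (All.zip (outside-All isx AR , x~)) ) S⊆)))
        where
        x~ : All (x ~_) (outside isx R)
        x~ = All.head (subst (All (λ y → All (y ~_) (outside isx R))) e (cross-adjacent isx cl))

    choose : Dec (wt w (MaxClique.Q with-x) + w x ≤ wt w (MaxClique.Q without-x)) → MaxClique w A (x ∷ us)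
    choose (yes le) = record
      { MaxClique without-x
      ; maximum = λ cl AR R⊆ → [ id , (λ h → ℕₚ.≤-trans h le) ]′ (bound cl AR R⊆) }
    choose (no nle) = record
      { Q = x ∷ MaxClique.Q with-x
      ; clique = All.map (proj₂ ∘ ∧-elim (A _)) (MaxClique.within with-x) ∷ MaxClique.clique with-x
      ; within = Ax ∷ All.map (proj₁ ∘ ∧-elim (A _)) (MaxClique.within with-x)
      ; maximum = λ cl AR R⊆ → ℕₚ.≤-trans
          ([ (λ h → ℕₚ.≤-trans h (ℕₚ.<⇒≤ (ℕₚ.≰⇒> nle))) , id ]′ (bound cl AR R⊆))
          (ℕₚ.≤-reflexive (ℕₚ.+-comm _ (w x))) }

  max-clique : ∀ w A → MaxClique w A vs
  max-clique w A = max-clique-among w A vs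

  everywhere : ∀ Q → All (_∈ vs) Q
  everywhere Q = All.tabulate λ {v} _ → complete v

  -- The colours of v are c v 0, …, c v (w v − 1).
  record Multicolouring (A : V → Bool) (w : V → ℕ) (N : ℕ) : Set where
    field
      colour    : V → ℕ → ℕ
      range     : ∀ {v i} → In A v → i < w v → colour v i < N
      injective : ∀ {v i j} → In A v → i < w v → j < w v → colour v i ≡ colour v j → i ≡ j
      proper    : ∀ {u v i j} → In A u → In A v → u ~ v → i < w u → j < w v → colour u i ≢ colour v j

  Bounded : (V → Bool) → (V → ℕ) → ℕ → Set
  Bounded A w N = ∀ {Q} → Clique Q → All (In A) Q → wt w Q ≤ N

  -- By Lovász's theorem this is equivalent to perfection of the subgraph on A;
  -- unlike perfection it is visibly preserved by substitution.
  WeightPerfect : (V → Bool) → Set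
  WeightPerfect A = ∀ w N → Bounded A w N → Multicolouring A w N

  single : ∀ {A w N v} → Bounded A w N → In A v → w v ≤ N
  single {w = w} {v = v} bd Av = ≡-≤-trans (sym (ℕₚ.+-identityʳ (w v))) (bd ([] ∷ []) (Av ∷ []))

  edge-bound : ∀ {A w N u v} → Bounded A w N → In A u → In A v → u ~ v → w u + w v ≤ N
  edge-bound {w = w} {u = u} {v} bd Au Av uv =
    ≡-≤-trans (cong (w u +_) (sym (ℕₚ.+-identityʳ (w v)))) (bd ((uv ∷ []) ∷ [] ∷ []) (Au ∷ Av ∷ []))

  -- One side uses colours from the bottom, the other from the top; the two intervals at an edge are
  -- disjoint because the edge weighs at most `N`.
  bipartite-perfect : ∀ {A} (side : V → Bool) →
    (∀ {u v} → In A u → In A v → u ~ v → side u ≢ side v) → WeightPerfect A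
  bipartite-perfect {A} side alternate w N bd = record
    { colour    = λ v i → place (side v) i
    ; range     = λ {v} Av i< → place-range (side v) (ℕₚ.<-≤-trans i< (single bd Av))
    ; injective = λ {v} Av i< j< → place-inj (side v) (ℕₚ.<-≤-trans i< (single bd Av)) (ℕₚ.<-≤-trans j< (single bd Av))
    ; proper    = λ Au Av uv i< j< → apart (alternate Au Av uv)
        (ℕₚ.≤-trans (ℕₚ.+-mono-≤ i< j<) (edge-bound bd Au Av uv)) }
    where
    place : Bool → ℕ → ℕ
    place false i = i
    place true  i = N ∸ suc i

    place-range : ∀ b {i} → i < N → place b i < N
    place-range false i< = i<
    place-range true {i} i< = ℕₚ.∸-monoʳ-< {N} {suc i} {0} (s≤s z≤n) i<

    place-inj : ∀ b {i j} → i < N → j < N → place b i ≡ place b j → i ≡ j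
    place-inj false _ _ e = e
    place-inj true i< j< e = ℕₚ.suc-injective (ℕₚ.∸-cancelˡ-≡ i< j< e)

    opposite : ∀ i j → suc i + suc j ≤ N → i ≢ N ∸ suc j
    opposite i j h e = ℕₚ.1+n≰n (ℕₚ.≤-trans (subst (λ k → suc k + suc j ≤ N) e h)
      (ℕₚ.≤-reflexive (sym (ℕₚ.m∸n+n≡m (ℕₚ.≤-trans (ℕₚ.m≤n+m (suc j) (suc i)) h)))))

    apart : ∀ {a b i j} → a ≢ b → suc i + suc j ≤ N → place a i ≢ place b j
    apart {false} {false} ne _ _ = ne refl
    apart {true}  {true}  ne _ _ = ne refl
    apart {false} {true} {i} {j} ne h e = opposite i j h e
    apart {true} {false} {i} {j} ne h e = opposite j i (subst (_≤ N) (ℕₚ.+-comm (suc i) (suc j)) h) (sym e)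

  -- Consecutive intervals of colours, starting at the partial sums of the weights.
  clique-perfect : ∀ {A} → (∀ {u v} → In A u → In A v → u ≢ v → u ~ v) → ∀ us → Clique us →
    All (In A) us → (∀ {v} → In A v → v ∈ us) → WeightPerfect A
  clique-perfect {A} complete-A us cl us⊆ ⊆us w N bd = record
    { colour    = λ v i → offset us v + i
    ; range     = λ Av i< → ℕₚ.<-≤-trans (in-range us (⊆us Av) i<) (bd cl us⊆)
    ; injective = λ {v} _ _ _ e → ℕₚ.+-cancelˡ-≡ (offset us v) _ _ e
    ; proper    = λ Au Av uv i< j< → separate us (⊆us Au) (⊆us Av) (~⇒≢ uv) i< j< }
    where
    offset : List V → V → ℕ
    offset [] v = 0
    offset (u ∷ us) v with v ≟ u
    ... | yes _ = 0
    ... | no _  = w u + offset us v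

    in-range : ∀ us {v i} → v ∈ us → i < w v → offset us v + i < wt w us
    in-range (u ∷ us) {v} v∈ i< with v ≟ u | v∈
    ... | yes refl | _        = ℕₚ.<-≤-trans i< (ℕₚ.m≤m+n (w u) _)
    ... | no ne | here e      = ⊥-elim (ne e)
    ... | no _  | there v∈us  = ≡-≤-trans (cong suc (ℕₚ.+-assoc (w u) _ _)) (ℕₚ.+-monoʳ-< (w u) (in-range us v∈us i<))

    separate : ∀ us {u v i j} → u ∈ us → v ∈ us → u ≢ v → i < w u → j < w v → offset us u + i ≢ offset us v + j
    separate (x ∷ us) {u} {v} {i} {j} u∈ v∈ ne i< j< e with u ≟ x | v ≟ x | u∈ | v∈
    ... | yes refl | yes refl | _ | _ = ne refl
    ... | no n | _ | here e′ | _ = n e′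
    ... | _ | no n | _ | here e′ = n e′
    ... | yes refl | no _ | _ | there _ =
      ℕₚ.<⇒≢ (ℕₚ.<-≤-trans i< (ℕₚ.≤-trans (ℕₚ.m≤m+n (w x) (offset us v)) (ℕₚ.m≤m+n _ j))) e
    ... | no _ | yes refl | there _ | _ =
      ℕₚ.<⇒≢ (ℕₚ.<-≤-trans j< (ℕₚ.≤-trans (ℕₚ.m≤m+n (w x) (offset us u)) (ℕₚ.m≤m+n _ i))) (sym e)
    ... | no _ | no _ | there u∈us | there v∈us = separate us u∈us v∈us ne i< j<
      (ℕₚ.+-cancelˡ-≡ (w x) _ _ (trans (sym (ℕₚ.+-assoc (w x) _ _)) (trans e (ℕₚ.+-assoc (w x) _ _))))

  add : (V → Bool) → V → V → Bool
  add A v u = A u ∨ ⌊ u ≟ v ⌋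

  add-in : ∀ {A v} → In (add A v) v
  add-in {A} {v} = ∨-inʳ (A v) (≟-true _≟_ refl)

  isolated-perfect : ∀ {A v} → (∀ {u} → In A u → v ≁ u) → WeightPerfect A → WeightPerfect (add A v)
  isolated-perfect {A} {v} anti perf w N bd = record
    { colour = colour′ ; range = range′ ; injective = injective′ ; proper = proper′ }
    where
    open Multicolouring (perf w N λ cl Q⊆ → bd cl (All.map ∨-inˡ Q⊆))
    colour′ : V → ℕ → ℕ
    colour′ u i with A u
    ... | true  = colour u i
    ... | false = i
    range′ : ∀ {u i} → In (add A v) u → i < w u → colour′ u i < N
    range′ {u} h i< with A u in Au
    ... | true  = range Au i<
    ... | false rewrite ≟-sound _≟_ h = ℕₚ.<-≤-trans i< (single bd (add-in {A}))
    injective′ : ∀ {u i j} → In (add A v) u → i < w u → j < w u → colour′ u i ≡ colour′ u j → i ≡ j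
    injective′ {u} h i< j< e with A u in Au
    ... | true  = injective Au i< j< e
    ... | false = e
    proper′ : ∀ {u u′ i j} → In (add A v) u → In (add A v) u′ → u ~ u′ → i < w u → j < w u′ → colour′ u i ≢ colour′ u′ j
    proper′ {u} {u′} h h′ uu′ i< j< with A u in Au | A u′ in Au′
    ... | true  | true  = proper Au Au′ uu′ i< j<
    ... | true  | false rewrite ≟-sound _≟_ h′ = λ _ → clash (~-sym uu′) (anti Au)
    ... | false | true  rewrite ≟-sound _≟_ h  = λ _ → clash uu′ (anti Au′)
    ... | false | false rewrite ≟-sound _≟_ h | ≟-sound _≟_ h′ = λ _ → ~⇒≢ uu′ refl

⌊⌋-true : ∀ {P : Set} (d : Dec P) → ⌊ d ⌋ ≡ true → P
⌊⌋-true (yes p) _ = p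

⌊⌋-true⁺ : ∀ {P : Set} (d : Dec P) → P → ⌊ d ⌋ ≡ true
⌊⌋-true⁺ (yes _) _ = refl
⌊⌋-true⁺ (no ¬p) p = ⊥-elim (¬p p)

∧-falseˡ : ∀ {a b} → a ∧ b ≡ false → a ≡ true → b ≡ false
∧-falseˡ h refl = h

-- Weighted perfect division

module Division {V : Set} (_≟_ : DecidableEquality V) (vs : List V) (complete : ∀ v → v ∈ vs) (unique : Unique vs)
  (E : V → V → Bool) (E-sym : ∀ u v → E u v ≡ E v u) (E-irr : ∀ v → E v v ≡ false) where

  open Adjacency E E-sym E-irr
  open Weights _≟_ vs complete E E-sym E-irr

  contract : (V → ℕ) → V → ℕ → V → ℕ
  contract w x m v = if ⌊ v ≟ x ⌋ then m else w v

  contract-at : ∀ w {x} m → contract w x m x ≡ m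
  contract-at w {x} m rewrite ≟-true _≟_ {x} refl = refl

  contract-off : ∀ w m {x v} → v ≢ x → contract w x m v ≡ w v
  contract-off w m v≢x rewrite ≟-false _≟_ v≢x = refl

  graft : (V → Bool) → (V → Bool) → (V → Bool) → V → Bool
  graft X B A v = if X v then B v else A v

  graft-in : ∀ {X B A v} → In X v → graft X B A v ≡ B v
  graft-in Xv rewrite Xv = refl

  graft-out : ∀ {X B A v} → Out X v → graft X B A v ≡ A v
  graft-out Xv rewrite Xv = refl

  Homogeneous : (V → Bool) → (V → Bool) → Set
  Homogeneous S X = ∀ {u a b} → In S u → Out X u → In X a → In X b → u ~ a → u ~ b

  module Substitution {X : V → Bool} {x : V} (Xx : In X x) where

    ≢x : ∀ {v} → Out X v → v ≢ x
    ≢x Xv refl = true≢false Xx Xv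

    wt-off : ∀ {w m Q} → All (Out X) Q → wt (contract w x m) Q ≡ wt w Q
    wt-off {w} {m} Q∉X = wt-≡ (All.map (λ Xv → contract-off w m (≢x Xv)) Q∉X)

    -- Replacing `x` by the clique `K` turns a clique of the contracted graph into one of the
    -- original graph, where `x` carries the weight of `K`.
    expand : ∀ {S Z : V → Bool} {w Q K} → Homogeneous S X → Clique Q → All (In S) Q →
      (∀ {v} → In S v → In X v → v ≡ x) → Clique K → All (In X) K → All (In Z) K →
      (∀ {v} → In S v → Out X v → In Z v) →
      ∃ λ R → Clique R × All (In Z) R × wt (contract w x (wt w K)) Q ≤ wt w R
    expand {S} {Z} {w} {Q} {K} hom clQ Q⊆S only-x clK K⊆X K⊆Z Z-off =
      go _ refl (constant-clique (inside-clique X clQ)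
        (All.map (λ (Sv , Xv) → only-x Sv Xv) (All.zip (inside-All X Q⊆S , inside-In X Q))))
      where
      O : List V
      O = outside X Q
      O⊆S : All (In S) O
      O⊆S = outside-All X Q⊆S
      O⊆Z : All (In Z) O
      O⊆Z = All.map (λ (Sv , Xv) → Z-off Sv Xv) (All.zip (O⊆S , outside-Out X Q))
      weight : ∀ {I} → inside X Q ≡ I → wt (contract w x (wt w K)) Q ≡ wt (contract w x (wt w K)) I + wt w O
      weight {I} e = trans (wt-split X (contract w x (wt w K)) Q)
        (trans (cong (λ I → wt (contract w x (wt w K)) I + wt (contract w x (wt w K)) O) e)
               (cong (wt (contract w x (wt w K)) I +_) (wt-off (outside-Out X Q))))
      go : ∀ I → inside X Q ≡ I → I ≡ [] ⊎ I ≡ x ∷ [] →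
        ∃ λ R → Clique R × All (In Z) R × wt (contract w x (wt w K)) Q ≤ wt w R
      go _ e (inj₁ refl) = O , outside-clique X clQ , O⊆Z , ℕₚ.≤-reflexive (weight e)
      go _ e (inj₂ refl) = K ++ O , AllPairsₚ.++⁺ clK (outside-clique X clQ) K~O , Allₚ.++⁺ K⊆Z O⊆Z ,
          ℕₚ.≤-reflexive (trans (weight e) (trans (cong (_+ wt w O) (trans (ℕₚ.+-identityʳ _) (contract-at w (wt w K)))) (sym (wt-++ w K O))))
        where
        x~O : All (x ~_) O
        x~O = All.head (subst (All (λ y → All (y ~_) O)) e (cross-adjacent X clQ))
        K~O : All (λ k → All (k ~_) O) K
        K~O = All.map (λ Xk → All.map (λ ((xo , So) , Xo) → ~-sym (hom So Xo Xx Xk (~-sym xo)))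
          (All.zip (All.zip (x~O , O⊆S) , outside-Out X Q))) K⊆X

    -- With `m` the maximum clique weight of B, the outer colouring reserves `m` colours for `x`,
    -- and an inner colouring of B with `m` colours selects among them.
    substitution-perfect : ∀ {A B} → In A x → Homogeneous A X → (∀ {v} → In A v → In X v → v ≡ x) →
      (∀ {v} → In B v → In X v) → WeightPerfect A → WeightPerfect B → WeightPerfect (graft X B A)
    substitution-perfect {A} {B} Ax hom only-x B⊆X perfA perfB w N bd = record
      { colour = colour′ ; range = range′ ; injective = injective′ ; proper = proper′ }
      where
      module K = MaxClique (max-clique w B)
      m : ℕ
      m = wt w K.Q
      w′ : V → ℕ
      w′ = contract w x m
      bd′ : Bounded A w′ N
      bd′ cl Q⊆ with expand {A} {graft X B A} {w} hom cl Q⊆ only-x K.clique (All.map B⊆X K.within)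
        (All.map (λ Bv → trans (graft-in {X} {B} {A} (B⊆X Bv)) Bv) K.within)
        (λ Av Xv → trans (graft-out {X} {B} {A} Xv) Av)
      ... | R , clR , R⊆ , le = ℕₚ.≤-trans le (bd clR R⊆)
      module Outer = Multicolouring (perfA w′ N bd′)
      module Inner = Multicolouring (perfB w m (λ cl Q⊆ → K.maximum cl Q⊆ (everywhere _)))
      at-x : ∀ {i} → i < m → i < w′ x
      at-x = subst (_ <_) (sym (contract-at w m))
      off-x : ∀ {v i} → Out X v → i < w v → i < w′ v
      off-x Xv = subst (_ <_) (sym (contract-off w m (≢x Xv)))
      colour′ : V → ℕ → ℕ
      colour′ v i with X v
      ... | true  = Outer.colour x (Inner.colour v i)
      ... | false = Outer.colour v i
      range′ : ∀ {v i} → In (graft X B A) v → i < w v → colour′ v i < N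
      range′ {v} h i< with X v in Xv
      ... | true  = Outer.range Ax (at-x (Inner.range h i<))
      ... | false = Outer.range h (off-x Xv i<)
      injective′ : ∀ {v i j} → In (graft X B A) v → i < w v → j < w v → colour′ v i ≡ colour′ v j → i ≡ j
      injective′ {v} h i< j< e with X v in Xv
      ... | true  = Inner.injective h i< j< (Outer.injective Ax (at-x (Inner.range h i<)) (at-x (Inner.range h j<)) e)
      ... | false = Outer.injective h (off-x Xv i<) (off-x Xv j<) e
      proper′ : ∀ {u v i j} → In (graft X B A) u → In (graft X B A) v → u ~ v → i < w u → j < w v → colour′ u i ≢ colour′ v j
      proper′ {u} {v} hu hv uv i< j< e with X u in Xu | X v in Xv
      ... | true  | true  = Inner.proper hu hv uv i< j<
        (Outer.injective Ax (at-x (Inner.range hu i<)) (at-x (Inner.range hv j<)) e)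
      ... | true  | false = Outer.proper hv Ax (hom hv Xv Xu Xx (~-sym uv))
        (off-x Xv j<) (at-x (Inner.range hu i<)) (sym e)
      ... | false | true  = Outer.proper hu Ax (hom hu Xu Xv Xx uv)
        (off-x Xu i<) (at-x (Inner.range hv j<)) e
      ... | false | false = Outer.proper hu hv uv (off-x Xu i<) (off-x Xv j<) e

  record Splits (S : V → Bool) (w : V → ℕ) (N : ℕ) : Set where
    field
      A       : V → Bool
      A⊆S     : ∀ {v} → In A v → In S v
      perfect : WeightPerfect A
      light   : ∀ {Q} → Clique Q → All (In S) Q → All (Out A) Q → wt w Q ≤ N

  -- Unlike in `WeightPerfect`, the weights are positive. The bound `suc N` need not be attained; if
  -- it is, the perfect set meets every clique attaining it.
  Divisible : (V → Bool) → Set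
  Divisible S = ∀ w → (∀ v → 1 ≤ w v) → ∀ N → Bounded S w (suc N) → Splits S w N

  module _ {S X S′ : V → Bool} {x : V} (Xx : In X x) (S′x : In S′ x) (X⊆S : ∀ {v} → In X v → In S v)
    (hom : Homogeneous S X) (S′⊆S : ∀ {v} → In S′ v → In S v) (only-x : ∀ {v} → In S′ v → In X v → v ≡ x)
    (S′-off : ∀ {v} → In S v → Out X v → In S′ v) where

    open Substitution {X} Xx

    -- If the perfect set of the contracted graph omits `x`, it serves unchanged: the part of a
    -- clique inside X weighs at most `m` and may be traded for `x`. If it contains `x`, a perfect
    -- set splitting X is substituted for `x`, and the inner part of an avoiding clique loses at
    -- least one unit.
    contraction-divisible : Divisible S′ → Divisible X → Divisible S
    contraction-divisible divS′ divX w pos N bd = choose (Splits.A D′ x) refl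
      where
      module K = MaxClique (max-clique w X)
      m : ℕ
      m = wt w K.Q
      w′ : V → ℕ
      w′ = contract w x m
      m-max : ∀ {Q} → Clique Q → All (In X) Q → wt w Q ≤ m
      m-max cl Q⊆ = K.maximum cl Q⊆ (everywhere _)
      m-pos : 1 ≤ m
      m-pos = ℕₚ.≤-trans (pos x) (≡-≤-trans (sym (ℕₚ.+-identityʳ (w x))) (m-max ([] ∷ []) (Xx ∷ [])))
      pos′ : ∀ v → 1 ≤ w′ v
      pos′ v with ⌊ v ≟ x ⌋
      ... | true  = m-pos
      ... | false = pos v
      bd′ : Bounded S′ w′ (suc N)
      bd′ cl Q⊆ with expand {S′} {S} {w} (λ Su → hom (S′⊆S Su)) cl Q⊆ only-x K.clique K.within (All.map X⊆S K.within) (λ Sv _ → S′⊆S Sv)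
      ... | R , clR , R⊆ , le = ℕₚ.≤-trans le (bd clR R⊆)
      D′ : Splits S′ w′ N
      D′ = divS′ w′ pos′ N bd′
      module D′ = Splits D′

      outside⊆S′ : ∀ {Q} → All (In S) Q → All (In S′) (outside X Q)
      outside⊆S′ {Q} Q⊆ = All.map (λ (Sv , Xv) → S′-off Sv Xv) (All.zip (outside-All X Q⊆ , outside-Out X Q))

      through-x : ∀ {Q} → Clique Q → All (In S) Q → inside X Q ≡ [] ⊎ Clique (x ∷ outside X Q)
      through-x {Q} cl Q⊆ = go (inside X Q) refl
        where
        go : ∀ I → inside X Q ≡ I → inside X Q ≡ [] ⊎ Clique (x ∷ outside X Q)
        go [] e = inj₁ e
        go (y ∷ I) e = inj₂ (All.map (λ ((yo , So) , Xo) → ~-sym (hom So Xo Xy Xx (~-sym yo)))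
            (All.zip (All.zip (y~O , outside-All X Q⊆) , outside-Out X Q)) ∷ outside-clique X cl)
          where
          Xy : In X y
          Xy = All.head (subst (All (In X)) e (inside-In X Q))
          y~O : All (y ~_) (outside X Q)
          y~O = All.head (subst (All (λ z → All (z ~_) (outside X Q))) e (cross-adjacent X cl))

      off-weight : ∀ Q → inside X Q ≡ [] → wt w Q ≡ wt w′ (outside X Q)
      off-weight Q e = trans (wt-split X w Q)
        (trans (cong (λ I → wt w I + wt w (outside X Q)) e) (sym (wt-off (outside-Out X Q))))

      x-weight : ∀ Q → wt w′ (x ∷ outside X Q) ≡ m + wt w (outside X Q)
      x-weight Q = trans (cong (_+ wt w′ (outside X Q)) (contract-at w m)) (cong (m +_) (wt-off (outside-Out X Q)))

      choose : ∀ b → Splits.A D′ x ≡ b → Splits S w N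
      choose false A′x = record
        { A = D′.A ; A⊆S = λ Av → S′⊆S (D′.A⊆S Av) ; perfect = D′.perfect
        ; light = λ {Q} cl Q⊆ Q∉ → case through-x cl Q⊆ of λ where
            (inj₁ e)   → ≡-≤-trans (off-weight Q e) (D′.light (outside-clique X cl) (outside⊆S′ Q⊆) (outside-All X Q∉))
            (inj₂ clx) → ≡-≤-trans (wt-split X w Q) (ℕₚ.≤-trans
              (ℕₚ.+-monoˡ-≤ (wt w (outside X Q)) (m-max (inside-clique X cl) (inside-In X Q)))
              (≡-≤-trans (sym (x-weight Q)) (D′.light clx (S′x ∷ outside⊆S′ Q⊆) (A′x ∷ outside-All X Q∉)))) }
      choose true A′x = with-inner m refl
        where
        -- Exposes `m` as a successor, the form of bound under which X can be split.
        with-inner : ∀ k → m ≡ k → Splits S w N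
        with-inner zero e = ⊥-elim (ℕₚ.1+n≰n (subst (1 ≤_) e m-pos))
        with-inner (suc m′) e = record
          { A = graft X DX.A D′.A
          ; A⊆S = A⊆
          ; perfect = substitution-perfect A′x (λ Au → hom (S′⊆S (D′.A⊆S Au))) (λ Av → only-x (D′.A⊆S Av)) DX.A⊆S D′.perfect DX.perfect
          ; light = light′ }
          where
          module DX = Splits (divX w pos m′ (λ cl Q⊆ → ℕₚ.≤-trans (m-max cl Q⊆) (ℕₚ.≤-reflexive e)))
          A⊆ : ∀ {v} → In (graft X DX.A D′.A) v → In S v
          A⊆ {v} h with X v in Xv
          ... | true  = X⊆S Xv
          ... | false = S′⊆S (D′.A⊆S h)
          light′ : ∀ {Q} → Clique Q → All (In S) Q → All (Out (graft X DX.A D′.A)) Q → wt w Q ≤ N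
          light′ {Q} cl Q⊆ Q∉ = case through-x cl Q⊆ of λ where
              (inj₁ e₀)  → ≡-≤-trans (off-weight Q e₀) (D′.light (outside-clique X cl) (outside⊆S′ Q⊆) O∉)
              (inj₂ clx) → ≡-≤-trans (wt-split X w Q) (ℕₚ.≤-trans
                (ℕₚ.+-monoˡ-≤ (wt w (outside X Q)) (DX.light (inside-clique X cl) (inside-In X Q) I∉))
                (ℕₚ.≤-pred (≡-≤-trans (trans (cong (_+ wt w (outside X Q)) (sym e)) (sym (x-weight Q)))
                  (bd′ clx (S′x ∷ outside⊆S′ Q⊆)))))
            where
            I∉ : All (Out DX.A) (inside X Q)
            I∉ = All.map (λ (Xv , h) → trans (sym (graft-in {X} {DX.A} {D′.A} Xv)) h) (All.zip (inside-In X Q , inside-All X Q∉))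
            O∉ : All (Out D′.A) (outside X Q)
            O∉ = All.map (λ (Xv , h) → trans (sym (graft-out {X} {DX.A} {D′.A} Xv)) h) (All.zip (outside-Out X Q , outside-All X Q∉))

  remove : (V → Bool) → V → V → Bool
  remove S v u = S u ∧ not ⌊ u ≟ v ⌋

  remove-⊆ : ∀ {S v u} → In (remove S v) u → In S u
  remove-⊆ {S} {v} {u} h = proj₁ (∧-elim (S u) h)

  remove-in : ∀ {S v u} → In S u → u ≢ v → In (remove S v) u
  remove-in Su u≢v = ∧-in Su (cong not (≟-false _≟_ u≢v))

  remove-≢ : ∀ {S v u} → In (remove S v) u → u ≢ v
  remove-≢ {S} {v} {u} h refl = true≢false (≟-true _≟_ refl) (not-true (proj₂ (∧-elim (S u) h)))

  drop-one : ∀ w {N} a Q → 1 ≤ w a → wt w (a ∷ Q) ≤ suc N → wt w Q ≤ N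
  drop-one w a Q pos h = ℕₚ.≤-pred (ℕₚ.≤-trans (ℕₚ.+-monoˡ-≤ (wt w Q) pos) h)

  nbr? : ∀ (A : V → Bool) v → Dec (∃ λ a → In A a × v ~ a)
  nbr? A v = map′ (λ h → let (a , _ , p) = find h in a , ∧-elim (A a) p) (λ (a , Aa , va) → lose (complete a) (∧-in Aa va))
    (Any.any? (λ a → (A a ∧ E v a) Bool.≟ true) vs)

  -- If `v` has no neighbour in the perfect set of the rest, it joins that set as an isolated
  -- vertex. If it has a neighbour `a` there, then `a` extends every avoiding clique through `v`.
  simplicial-divisible : ∀ {S v} → In S v → (∀ {a b} → In S a → In S b → v ~ a → v ~ b → a ≢ b → a ~ b) →
    Divisible (remove S v) → Divisible S
  simplicial-divisible {S} {v} Sv simp div w pos N bd = choose (nbr? Rest.A v)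
    where
    module Rest = Splits (div w pos N λ cl Q⊆ → bd cl (All.map (remove-⊆ {S}) Q⊆))
    choose : Dec (∃ λ a → In Rest.A a × v ~ a) → Splits S w N
    choose (no none) = record
      { A = add Rest.A v
      ; A⊆S = λ {u} h → [ (λ Au → remove-⊆ {S} (Rest.A⊆S Au)) , (λ e → subst (In S) (sym (≟-sound _≟_ e)) Sv) ]′ (∨-elim (Rest.A u) h)
      ; perfect = isolated-perfect (λ {u} Au → nonadj λ vu → none (u , Au , vu)) Rest.perfect
      ; light = λ cl Q⊆ Q∉ → Rest.light cl
          (All.map (λ (Su , h) → remove-in {S} Su λ { refl → true≢false (add-in {Rest.A}) h }) (All.zip (Q⊆ , Q∉)))
          (All.map (λ h → ¬true⇒false λ Au → true≢false (∨-inˡ Au) h) Q∉) }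
    choose (yes (a , Aa , va)) = record
      { A = Rest.A ; A⊆S = λ Au → remove-⊆ {S} (Rest.A⊆S Au) ; perfect = Rest.perfect ; light = light′ }
      where
      Sa : In S a
      Sa = remove-⊆ {S} (Rest.A⊆S Aa)
      light′ : ∀ {Q} → Clique Q → All (In S) Q → All (Out Rest.A) Q → wt w Q ≤ N
      light′ {Q} cl Q⊆ Q∉ = go (Any.any? (v ≟_) Q)
        where
        go : Dec (v ∈ Q) → wt w Q ≤ N
        go (no v∉) = Rest.light cl (All.tabulate λ {u} u∈ → remove-in {S} (All.lookup Q⊆ u∈) λ { refl → v∉ u∈ }) Q∉
        go (yes v∈) = drop-one w a Q (pos a) (bd (All.tabulate a~ ∷ cl) (Sa ∷ Q⊆))
          where
          a~ : ∀ {u} → u ∈ Q → a ~ u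
          a~ {u} u∈ with u ≟ v
          ... | yes refl = ~-sym va
          ... | no u≢v = simp Sa (All.lookup Q⊆ u∈) va (member-pairs ~-sym cl v∈ u∈ (≢-sym u≢v)) λ { refl → true≢false Aa (All.lookup Q∉ u∈) }

  -- Every clique avoiding A extends by v.
  dominated-divisible : ∀ {S A v} → In S v → (∀ {u} → In A u → In S u) → WeightPerfect A →
    (∀ {u} → In S u → Out A u → v ~ u) → Divisible S
  dominated-divisible {S} {A} {v} Sv A⊆S perf dom w pos N bd = record
    { A = A ; A⊆S = A⊆S ; perfect = perf
    ; light = λ {Q} cl Q⊆ Q∉ → drop-one w v Q (pos v)
        (bd (All.map (λ (Su , Au) → dom Su Au) (All.zip (Q⊆ , Q∉)) ∷ cl) (Sv ∷ Q⊆)) }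

  far : (V → Bool) → V → V → Bool
  far S v u = S u ∧ not (E v u)

  far-in : ∀ {S v u} → In S u → v ≁ u → In (far S v) u
  far-in Su vu = ∧-in Su (cong not vu)

  far-S : ∀ {S v u} → In (far S v) u → In S u
  far-S {S} {v} {u} h = proj₁ (∧-elim (S u) h)

  far-≁ : ∀ {S v u} → In (far S v) u → v ≁ u
  far-≁ {S} {v} {u} h = not-true (proj₂ (∧-elim (S u) h))

  costable-divisible : ∀ {S v} → In S v → (∀ {a b} → In S a → In S b → v ≁ a → v ≁ b → a ≁ b) → Divisible S
  costable-divisible {S} {v} Sv stable = dominated-divisible Sv (far-S {S})
    (bipartite-perfect {far S v} (λ _ → false) λ Aa Ab ab → ⊥-elim (clash ab (stable (far-S {S} Aa) (far-S {S} Ab) (far-≁ {S} Aa) (far-≁ {S} Ab))))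
    λ Su Au → adj λ vu → true≢false (far-in {S} Su vu) Au

  coclique-divisible : ∀ {S v} → In S v →
    (∀ {a b} → In S a → In S b → a ≢ v → v ≁ a → b ≢ v → v ≁ b → a ≢ b → a ~ b) → Divisible S
  coclique-divisible {S} {v} Sv clique = dominated-divisible Sv
      (λ {u} h → [ (λ Mu → far-S {S} (remove-⊆ {far S v} Mu)) , (λ e → subst (In S) (sym (≟-sound _≟_ e)) Sv) ]′ (∨-elim (M u) h))
      (isolated-perfect (λ Mu → far-≁ {S} (remove-⊆ {far S v} Mu))
        (clique-perfect {M} M-clique Ms Ms-clique (Allₚ.all-filter M? vs) λ Mu → ∈-filter⁺ M? (complete _) Mu))
      λ {u} Su h → adj λ vu → true≢false
        (∨-inˡ (remove-in {far S v} (far-in {S} Su vu) λ { refl → true≢false (add-in {M}) h })) h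
    where
    M : V → Bool
    M = remove (far S v) v
    M? : ∀ u → Dec (In M u)
    M? u = M u Bool.≟ true
    Ms : List V
    Ms = filter M? vs
    M-clique : ∀ {a b} → In M a → In M b → a ≢ b → a ~ b
    M-clique Ma Mb = clique (far-S {S} (remove-⊆ {far S v} Ma)) (far-S {S} (remove-⊆ {far S v} Mb))
      (remove-≢ {far S v} Ma) (far-≁ {S} (remove-⊆ {far S v} Ma)) (remove-≢ {far S v} Mb) (far-≁ {S} (remove-⊆ {far S v} Mb))
    pairwise : ∀ {us} → Unique us → All (In M) us → Clique us
    pairwise [] [] = []
    pairwise (ne ∷ u) (Mx ∷ Mus) = All.map (λ (n , My) → M-clique Mx My n) (All.zip (ne , Mus)) ∷ pairwise u Mus
    Ms-clique : Clique Ms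
    Ms-clique = pairwise (AllPairsₚ.filter⁺ M? unique) (Allₚ.all-filter M? vs)

  -- Removing the whole third class would be too much, since an isolated vertex of large weight may
  -- be a maximum clique. Only its non-isolated vertices are removed; each has a neighbour of
  -- positive weight, so its own weight is at most `N`.
  tripartite-divisible : ∀ {S} (third side : V → Bool) →
    (∀ {u v} → In S u → In S v → u ~ v → In third u → In third v → ⊥) →
    (∀ {u v} → In S u → In S v → u ~ v → Out third u → Out third v → side u ≢ side v) → Divisible S
  tripartite-divisible {S} third side stable alternate w pos N bd = record
    { A = A ; A⊆S = λ {u} Au → proj₁ (∧-elim (S u) Au)
    ; perfect = bipartite-perfect {A} side λ Au Av uv → alternate (A-S Au) (A-S Av) uv
        (A-out Au (A-S Av) uv) (A-out Av (A-S Au) (~-sym uv))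
    ; light = light′ }
    where
    has-nbr : V → Bool
    has-nbr u = ⌊ nbr? S u ⌋
    A : V → Bool
    A u = S u ∧ not (third u ∧ has-nbr u)
    A-S : ∀ {u} → In A u → In S u
    A-S {u} Au = proj₁ (∧-elim (S u) Au)
    A-out : ∀ {u v} → In A u → In S v → u ~ v → Out third u
    A-out {u} {v} Au Sv uv = ¬true⇒false λ tu → true≢false
      (∧-in tu (⌊⌋-true⁺ (nbr? S u) (v , Sv , uv))) (not-true (proj₂ (∧-elim (S u) Au)))
    not-A : ∀ {u} → In S u → Out A u → In third u × (∃ λ z → In S z × u ~ z)
    not-A {u} Su Au with ∧-elim (third u) (not-false (∧-falseˡ Au Su))
    ... | tu , h = tu , ⌊⌋-true (nbr? S u) h
    light′ : ∀ {Q} → Clique Q → All (In S) Q → All (Out A) Q → wt w Q ≤ N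
    light′ {[]} _ _ _ = z≤n
    light′ {u ∷ []} _ (Su ∷ []) (Au ∷ []) with not-A Su Au
    ... | _ , z , Sz , uz = drop-one w z (u ∷ []) (pos z) (bd ((~-sym uz ∷ []) ∷ [] ∷ []) (Sz ∷ Su ∷ []))
    light′ {u ∷ v ∷ _} ((uv ∷ _) ∷ _) (Su ∷ Sv ∷ _) (Au ∷ Av ∷ _) =
      ⊥-elim (stable Su Sv uv (proj₁ (not-A Su Au)) (proj₁ (not-A Sv Av)))

-- The structure theorem for prime graphs

module Structure {V : Set} (_≟_ : DecidableEquality V) (vs : List V) (complete : ∀ v → v ∈ vs)
  (E : V → V → Bool) (E-sym : ∀ u v → E u v ≡ E v u) (E-irr : ∀ v → E v v ≡ false) where

  open Adjacency E E-sym E-irr public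
  open Complement _≟_ E E-sym E-irr
  open Diamond _≟_ E E-sym E-irr using (CoClique; coclique) public

  Avoids : Choice → Set
  Avoids house-c   = NoHouse
  Avoids hammer-c  = NoHammer
  Avoids diamond-c = NoDiamond

  CoStable : V → Set
  CoStable v = ∀ {a b} → v ≁ a → v ≁ b → a ≁ b

  no-co-triangle : Prime → NoBull → No2K2 → (∀ v → ¬ CoStable v) → ∀ {x y z} → ¬ Co.Triangle x y z
  no-co-triangle prime no-bull no-2K2 no-costable triangle =
    SimplicialVertex.simplicial-exists _≟_ vs complete co co-sym co-irr
      (co-prime prime) (co-bull-free no-bull) (co-C4-free no-2K2) triangle
      λ v simp → no-costable v λ {a} {b} va vb → costable v simp a b va vb
    where
    costable : ∀ v → Co.Simplicial v → ∀ a b → v ≁ a → v ≁ b → a ≁ b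
    costable v simp a b va vb with a ≟ v | b ≟ v | a ≟ b
    ... | yes refl | _ | _ = vb
    ... | _ | yes refl | _ = ≁-sym va
    ... | _ | _ | yes refl = E-irr a
    ... | no a≢v | no b≢v | no a≢b = co⇒≁ (simp (co-in (≢-sym a≢v) va) (co-in (≢-sym b≢v) vb) a≢b)

  structure : ∀ h → Prime → NoBull → Avoids h → ∀ {x y z} → Triangle x y z →
    (∀ v → ¬ Simplicial v) → (∀ v → ¬ CoClique v) → (∀ v → ¬ CoStable v) → ⊥
  structure house-c prime no-bull no-house triangle no-simp _ _ =
    SimplicialVertex.simplicial-exists _≟_ vs complete E E-sym E-irr prime no-bull
      (House.no-C4 _≟_ vs complete E E-sym E-irr prime no-bull no-house triangle) triangle no-simp
  structure hammer-c prime no-bull no-hammer {x} triangle _ no-coclique no-costable =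
    -- By `no-co-triangle` there is no stable set of size three, so the non-neighbours of any vertex
    -- form a clique.
    no-coclique x λ m≢x xm m′≢x xm′ m≢m′ → adj λ mm′ →
      no-co-triangle prime no-bull (Hammer.no-2K2 _≟_ vs complete E E-sym E-irr prime no-bull no-hammer triangle)
        no-costable (co-in (≢-sym m≢x) xm , co-in (≢-sym m′≢x) xm′ , co-in m≢m′ mm′)
  structure diamond-c prime no-bull no-diamond {x} triangle no-simp no-coclique _ =
    no-coclique x (coclique prime no-bull no-diamond no-simp triangle)

-- Induction over vertex subsets

module Induction (Γ : Graph) where

  V : Set
  V = Fin (order Γ)

  vertices : List V
  vertices = allFin (order Γ)

  open Adjacency (edge Γ) (adj-sym Γ) (adj-irrefl Γ)
  open Weights Fin._≟_ vertices ∈-allFin (edge Γ) (adj-sym Γ) (adj-irrefl Γ)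
  open Division Fin._≟_ vertices ∈-allFin (Uniqueₚ.allFin⁺ (order Γ)) (edge Γ) (adj-sym Γ) (adj-irrefl Γ)

  module _ (S : V → Bool) where

    in? : ∀ A (v : V) → Dec (In A v)
    in? A v = A v Bool.≟ true
    out? : ∀ A (v : V) → Dec (Out A v)
    out? A v = A v Bool.≟ false
    adj? : ∀ (u v : V) → Dec (u ~ v)
    adj? u v = edge Γ u v Bool.≟ true
    nonadj? : ∀ (u v : V) → Dec (u ≁ v)
    nonadj? u v = edge Γ u v Bool.≟ false

    -- The decidable form of a nontrivial homogeneous set of the subgraph on S, suited to a search
    -- over all subsets.
    Splitting : (V → Bool) → Set
    Splitting X =
      (∃ λ x → ∃ λ y → In X x × In X y × x ≢ y) × (∃ λ z → In S z × Out X z) × (∀ v → In X v → In S v) ×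
      (∀ u a b → In S u → Out X u → In X a → In X b → u ~ a → u ~ b)

    splitting? : ∀ X → Dec (Splitting X)
    splitting? X =
      Finₚ.any? (λ x → Finₚ.any? λ y → in? X x ×-dec in? X y ×-dec ¬? (x Fin.≟ y)) ×-dec
      Finₚ.any? (λ z → in? S z ×-dec out? X z) ×-dec
      Finₚ.all? (λ v → in? X v →-dec in? S v) ×-dec
      Finₚ.all? (λ u → Finₚ.all? λ a → Finₚ.all? λ b →
        in? S u →-dec out? X u →-dec in? X a →-dec in? X b →-dec adj? u a →-dec adj? u b)

    splitting-resp : ∀ {X Y} → (∀ v → X v ≡ Y v) → Splitting X → Splitting Y
    splitting-resp {X} {Y} e ((x , y , Xx , Xy , x≢y) , (z , Sz , Xz) , X⊆S , hom) =
      (x , y , to Xx , to Xy , x≢y) , (z , Sz , to Xz) , (λ v Yv → X⊆S v (from Yv)) ,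
      λ u a b Su Yu Ya Yb → hom u a b Su (from Yu) (from Ya) (from Yb)
      where
      to : ∀ {v b} → X v ≡ b → Y v ≡ b
      to {v} h = trans (sym (e v)) h
      from : ∀ {v b} → Y v ≡ b → X v ≡ b
      from {v} h = trans (e v) h

    splitting-exists? : Dec (∃ Splitting)
    splitting-exists? with anySubset? (λ p → splitting? (Vec.lookup p))
    ... | yes (p , h) = yes (Vec.lookup p , h)
    ... | no none = no λ (X , h) → none (Vec.tabulate X ,
            splitting-resp (λ v → sym (Vecₚ.lookup∘tabulate X v)) h)

    -- The structure theory speaks of a whole vertex type, so the induced subgraph is presented as a
    -- subtype.
    VS : Set
    VS = Σ V (In S)

    VS-≡ : ∀ {u v : VS} → proj₁ u ≡ proj₁ v → u ≡ v
    VS-≡ {u , p} {.u , q} refl = cong (u ,_) (Decidable⇒UIP.≡-irrelevant Bool._≟_ p q)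

    _≟S_ : DecidableEquality VS
    u ≟S v = map′ VS-≡ (cong proj₁) (proj₁ u Fin.≟ proj₁ v)

    restrict : List V → List VS
    restrict [] = []
    restrict (v ∷ us) with in? S v
    ... | yes Sv = (v , Sv) ∷ restrict us
    ... | no _   = restrict us

    restrict-complete : ∀ {us} v → proj₁ v ∈ us → v ∈ restrict us
    restrict-complete {u ∷ us} (v , Sv) v∈ with in? S u | v∈
    ... | yes _  | here refl = here (VS-≡ refl)
    ... | yes _  | there i   = there (restrict-complete (v , Sv) i)
    ... | no ¬Su | here refl = ⊥-elim (¬Su Sv)
    ... | no _   | there i   = restrict-complete (v , Sv) i

    E-S : VS → VS → Bool
    E-S u v = edge Γ (proj₁ u) (proj₁ v)

    module Str = Structure _≟S_ (restrict vertices) (λ v → restrict-complete v (∈-allFin (proj₁ v)))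
      E-S (λ u v → adj-sym Γ (proj₁ u) (proj₁ v)) (λ v → adj-irrefl Γ (proj₁ v))

    -- Bridges arbitrary predicates in `Prime` and Boolean sets in `Splitting`: on a finite list,
    -- decidability may be assumed when proving `⊥`.
    ¬¬-decidable : ∀ (X : VS → Set) us → ¬ ¬ All (λ v → Dec (X v)) us
    ¬¬-decidable X [] k = k []
    ¬¬-decidable X (u ∷ us) k = ¬¬-decidable X us λ ds → k (no (λ Xu → k (yes Xu ∷ ds)) ∷ ds)

    prime : ¬ ∃ Splitting → Str.Prime
    prime unsplit X {x} {y} {z} Xx Xy x≢y ¬Xz mix = ¬¬-decidable X _ λ ds →
        let dec = λ v → All.lookup ds (restrict-complete v (∈-allFin (proj₁ v))) in splits dec
      where
      splits : (∀ v → Dec (X v)) → ⊥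
      splits dec = unsplit (X′ , (proj₁ x , proj₁ y , X′-in Xx , X′-in Xy , λ e → x≢y (VS-≡ e)) ,
          (proj₁ z , proj₂ z , X′-out ¬Xz) , (λ v h → proj₁ (X′-in⁻ v h)) ,
          λ u a b Su Xu Xa Xb ua → adj λ ub →
            let (Sa , Xa′) = X′-in⁻ a Xa
                (Sb , Xb′) = X′-in⁻ b Xb
            in mix (u , Su) (λ Xu′ → true≢false (X′-in Xu′) Xu) Xa′ Xb′ ua ub)
        where
        X′ : V → Bool
        X′ v with in? S v
        ... | yes Sv = ⌊ dec (v , Sv) ⌋
        ... | no _   = false
        X′-in : ∀ {v} → X v → In X′ (proj₁ v)
        X′-in {v , Sv} Xv with in? S v
        ... | no ¬Sv = ⊥-elim (¬Sv Sv)
        ... | yes Sv′ = ⌊⌋-true⁺ (dec (v , Sv′)) (subst X (VS-≡ refl) Xv)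
        X′-out : ∀ {v} → ¬ X v → Out X′ (proj₁ v)
        X′-out {v , Sv} ¬Xv with in? S v
        ... | no _ = refl
        ... | yes Sv′ = ¬true⇒false λ h → ¬Xv (subst X (VS-≡ refl) (⌊⌋-true (dec (v , Sv′)) h))
        X′-in⁻ : ∀ v → In X′ v → Σ (In S v) λ Sv → X (v , Sv)
        X′-in⁻ v h with in? S v
        ... | yes Sv = Sv , ⌊⌋-true (dec (v , Sv)) h

    TriangleIn : Set
    TriangleIn = ∃ λ a → ∃ λ b → ∃ λ c → In S a × In S b × In S c × Triangle a b c

    triangle? : Dec TriangleIn
    triangle? = Finₚ.any? λ a → Finₚ.any? λ b → Finₚ.any? λ c →
      in? S a ×-dec in? S b ×-dec in? S c ×-dec adj? a b ×-dec adj? a c ×-dec adj? b c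

    SimplicialIn CoCliqueIn CoStableIn : V → Set
    SimplicialIn v = ∀ a b → In S a → In S b → v ~ a → v ~ b → a ≢ b → a ~ b
    CoCliqueIn v = ∀ a b → In S a → In S b → a ≢ v → v ≁ a → b ≢ v → v ≁ b → a ≢ b → a ~ b
    CoStableIn v = ∀ a b → In S a → In S b → v ≁ a → v ≁ b → a ≁ b

    simplicial? : Dec (∃ λ v → In S v × SimplicialIn v)
    simplicial? = Finₚ.any? λ v → in? S v ×-dec Finₚ.all? λ a → Finₚ.all? λ b →
      in? S a →-dec in? S b →-dec adj? v a →-dec adj? v b →-dec ¬? (a Fin.≟ b) →-dec adj? a b

    coclique? : Dec (∃ λ v → In S v × CoCliqueIn v)
    coclique? = Finₚ.any? λ v → in? S v ×-dec Finₚ.all? λ a → Finₚ.all? λ b →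
      in? S a →-dec in? S b →-dec ¬? (a Fin.≟ v) →-dec nonadj? v a →-dec ¬? (b Fin.≟ v) →-dec nonadj? v b →-dec
      ¬? (a Fin.≟ b) →-dec adj? a b

    costable? : Dec (∃ λ v → In S v × CoStableIn v)
    costable? = Finₚ.any? λ v → in? S v ×-dec Finₚ.all? λ a → Finₚ.all? λ b →
      in? S a →-dec in? S b →-dec nonadj? v a →-dec nonadj? v b →-dec nonadj? a b

  module _ (h : Choice) (no-bull : NoBull) (avoids : Structure.Avoids Fin._≟_ vertices ∈-allFin (edge Γ) (adj-sym Γ) (adj-irrefl Γ) h)
    (triangle-free-divisible : ∀ S → ¬ TriangleIn S → Divisible S) where

    avoids-in : ∀ S h → Structure.Avoids Fin._≟_ vertices ∈-allFin (edge Γ) (adj-sym Γ) (adj-irrefl Γ) h → Str.Avoids S h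
    avoids-in S house-c   avoids = avoids
    avoids-in S hammer-c  avoids = avoids
    avoids-in S diamond-c avoids = λ ab ac ad bc bd cd c≢d → avoids ab ac ad bc bd cd λ e → c≢d (VS-≡ S e)

    no-structure : ∀ S → ¬ ∃ (Splitting S) → TriangleIn S → ¬ (∃ λ v → In S v × SimplicialIn S v) →
      ¬ (∃ λ v → In S v × CoCliqueIn S v) → ¬ (∃ λ v → In S v × CoStableIn S v) → ⊥
    no-structure S unsplit (a , b , c , Sa , Sb , Sc , tri) ¬simp ¬cocl ¬cost =
      Str.structure S h (prime S unsplit) no-bull (avoids-in S h avoids) {a , Sa} {b , Sb} {c , Sc} tri
        (λ (v , Sv) simp → ¬simp (v , Sv , λ a b Sa Sb va vb a≢b → simp {a , Sa} {b , Sb} va vb (a≢b ∘ cong proj₁)))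
        (λ (v , Sv) cocl → ¬cocl (v , Sv , λ a b Sa Sb a≢v va b≢v vb a≢b →
          cocl {a , Sa} {b , Sb} (a≢v ∘ cong proj₁) va (b≢v ∘ cong proj₁) vb (a≢b ∘ cong proj₁)))
        (λ (v , Sv) cost → ¬cost (v , Sv , λ a b Sa Sb va vb → cost {a , Sa} {b , Sb} va vb))

    divisible-acc : ∀ S → Acc _<_ (count S vertices) → Divisible S
    divisible-acc S (acc rs) with splitting-exists? S
    ... | yes (X , (x , y , Xx , Xy , x≢y) , (z , Sz , Xz) , X⊆S , hom) =
      contraction-divisible {S} {X} {S′} Xx (∧-in (X⊆S x Xx) (∨-inʳ (not (X x)) (≟-true Fin._≟_ refl))) (λ {v} → X⊆S v)
        (λ {u} {a} {b} → hom u a b) S′⊆S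
        (λ {v} S′v Xv → [ (λ nX → ⊥-elim (true≢false Xv (not-true nX))) , ≟-sound Fin._≟_ ]′ (∨-elim (not (X v)) (proj₂ (∧-elim (S v) S′v))))
        (λ Sv Xv → ∧-in Sv (∨-inˡ (cong not Xv)))
        (divisible-acc S′ (rs (count-strict (λ v → S′⊆S {v}) (X⊆S y Xy) S′y (∈-allFin y))))
        (divisible-acc X (rs (count-strict X⊆S Sz Xz (∈-allFin z))))
      where
      -- X collapsed to its representative `x`; `y` is lost, so the measure drops.
      S′ : V → Bool
      S′ v = S v ∧ (not (X v) ∨ ⌊ v Fin.≟ x ⌋)
      S′⊆S : ∀ {v} → In S′ v → In S v
      S′⊆S {v} h = proj₁ (∧-elim (S v) h)
      S′y : Out S′ y
      S′y rewrite Xy | ≟-false Fin._≟_ (≢-sym x≢y) | X⊆S y Xy = refl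
    ... | no unsplit with triangle? S
    ...   | no ¬tri = triangle-free-divisible S ¬tri
    ...   | yes tri with simplicial? S
    ...     | yes (v , Sv , simp) = simplicial-divisible Sv (λ {a} {b} → simp a b)
                (divisible-acc (remove S v) (rs (count-strict (λ u → remove-⊆ {S} {v} {u}) Sv out-v (∈-allFin v))))
      where
      out-v : Out (remove S v) v
      out-v rewrite ≟-true Fin._≟_ {v} refl | Sv = refl
    ...     | no ¬simp with coclique? S
    ...       | yes (v , Sv , cocl) = coclique-divisible Sv (λ {a} {b} → cocl a b)
    ...       | no ¬cocl with costable? S
    ...         | yes (v , Sv , cost) = costable-divisible Sv (λ {a} {b} → cost a b)
    ...         | no ¬cost = ⊥-elim (no-structure S unsplit tri ¬simp ¬cocl ¬cost)

    divisible : ∀ S → Divisible S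
    divisible S = divisible-acc S (<-wellFounded _)

-- Forbidden induced subgraphs as adjacency patterns

T⇒ : ∀ {b} → T b → b ≡ true
T⇒ = Equivalence.to T-≡

⇒T : ∀ {b} → b ≡ true → T b
⇒T = Equivalence.from T-≡

lookup-pairs : ∀ {A : Set} {R : A → A → Set} → (∀ {x y} → R x y → R y x) →
  ∀ {xs} → AllPairs R xs → ∀ i j → i ≢ j → R (lookup xs i) (lookup xs j)
lookup-pairs R-sym (p ∷ ps) zero    zero    i≢j = ⊥-elim (i≢j refl)
lookup-pairs R-sym (p ∷ ps) zero    (suc j) i≢j = All.lookup p (∈-lookup j)
lookup-pairs R-sym (p ∷ ps) (suc i) zero    i≢j = R-sym (All.lookup p (∈-lookup i))
lookup-pairs R-sym (p ∷ ps) (suc i) (suc j) i≢j = lookup-pairs R-sym ps i j (i≢j ∘ cong suc)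

agree-on-pairs : ∀ K G (f : Fin (order K) → Fin (order G)) →
  AllPairs (λ i j → edge K i j ≡ edge G (f i) (f j)) (allFin (order K)) → ∀ i j → edge K i j ≡ edge G (f i) (f j)
agree-on-pairs K G f ps i j with i Fin.≟ j
... | yes refl = trans (adj-irrefl K i) (sym (adj-irrefl G (f i)))
... | no i≢j   = member-pairs {R = λ i j → edge K i j ≡ edge G (f i) (f j)}
  (λ {i} {j} e → trans (adj-sym K j i) (trans e (adj-sym G (f i) (f j)))) ps (∈-allFin i) (∈-allFin j) i≢j

embed : ∀ K G (f : Fin (order K) → Fin (order G)) → Injective _≡_ _≡_ f →
  AllPairs (λ i j → edge K i j ≡ edge G (f i) (f j)) (allFin (order K)) → Embedding K G
embed K G f inj ps = f , inj , agree-on-pairs K G f ps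

TwinFree : Graph → Set
TwinFree K = ∀ i j → (∀ k → edge K i k ≡ edge K j k) → i ≡ j

twin-free? : ∀ K → Dec (TwinFree K)
twin-free? K = Finₚ.all? λ i → Finₚ.all? λ j →
  Finₚ.all? (λ k → edge K i k Bool.≟ edge K j k) →-dec (i Fin.≟ j)

-- Vertices with equal images have equal neighbourhoods, so injectivity is automatic for the bull,
-- the house and the hammer. The diamond has two nonadjacent twins, hence the hypothesis `c ≢ d` in
-- `NoDiamond`.
embed-twin-free : ∀ K G → TwinFree K → (f : Fin (order K) → Fin (order G)) →
  AllPairs (λ i j → edge K i j ≡ edge G (f i) (f j)) (allFin (order K)) → Embedding K G
embed-twin-free K G twin-free f ps = embed K G f inj ps
  where
  agree : ∀ i j → edge K i j ≡ edge G (f i) (f j)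
  agree = agree-on-pairs K G f ps
  inj : Injective _≡_ _≡_ f
  inj {i} {j} e = twin-free i j λ k → trans (agree i k) (trans (cong (λ v → edge G v (f k)) e) (sym (agree j k)))

module Patterns (G : Graph) where

  open Adjacency (edge G) (adj-sym G) (adj-irrefl G)

  bull-free : Free G bull → NoBull
  bull-free free {a} {b} {c} {d} {e} ab ac bc ad be ae bd cd ce de =
    free (embed-twin-free bull G (from-yes (twin-free? bull)) (Vec.lookup (a ∷ b ∷ c ∷ d ∷ e ∷ []))
      ((sym ab ∷ sym ac ∷ sym ad ∷ sym ae ∷ []) ∷ (sym bc ∷ sym bd ∷ sym be ∷ []) ∷
       (sym cd ∷ sym ce ∷ []) ∷ (sym de ∷ []) ∷ [] ∷ []))

  house-free : Free G house → NoHouse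
  house-free free {p} {q} {r} {s} {t} pq qr rs sp pr qs tp tq tr ts =
    -- `p r t s q` is the path whose complement is the house.
    free (embed-twin-free house G (from-yes (twin-free? house)) (Vec.lookup (p ∷ r ∷ t ∷ s ∷ q ∷ []))
      ((sym pr ∷ sym (~-sym tp) ∷ sym (~-sym sp) ∷ sym pq ∷ []) ∷ (sym (≁-sym tr) ∷ sym rs ∷ sym (~-sym qr) ∷ []) ∷
       (sym ts ∷ sym tq ∷ []) ∷ (sym (≁-sym qs) ∷ []) ∷ [] ∷ []))

  hammer-free : Free G hammer → NoHammer
  hammer-free free {a} {b} {c} {d} {e} ab ac bc ad de bd cd ae be ce =
    free (embed-twin-free hammer G (from-yes (twin-free? hammer)) (Vec.lookup (a ∷ b ∷ c ∷ d ∷ e ∷ []))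
      ((sym ab ∷ sym ac ∷ sym ad ∷ sym ae ∷ []) ∷ (sym bc ∷ sym bd ∷ sym be ∷ []) ∷
       (sym cd ∷ sym ce ∷ []) ∷ (sym de ∷ []) ∷ [] ∷ []))

  distinct-lookup : ∀ {us : List (Fin (order G))} → Unique us → Injective _≡_ _≡_ (lookup us)
  distinct-lookup u {i} {j} e with i Fin.≟ j
  ... | yes i≡j = i≡j
  ... | no i≢j  = ⊥-elim (lookup-pairs ≢-sym u i j i≢j e)

  diamond-free : Free G diamond → NoDiamond
  diamond-free free {a} {b} {c} {d} ab ac ad bc bd cd c≢d =
    free (embed diamond G (lookup (a ∷ b ∷ c ∷ d ∷ [])) (distinct-lookup
        ((~⇒≢ ab ∷ ~⇒≢ ac ∷ ~⇒≢ ad ∷ []) ∷ (~⇒≢ bc ∷ ~⇒≢ bd ∷ []) ∷ (c≢d ∷ []) ∷ [] ∷ []))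
      ((sym ab ∷ sym ac ∷ sym ad ∷ []) ∷ (sym bc ∷ sym bd ∷ []) ∷ (sym cd ∷ []) ∷ [] ∷ []))

  triangle-embeds : ∀ {a b c} → Triangle a b c → Embedding triangle G
  triangle-embeds {a} {b} {c} (ab , ac , bc) =
    embed triangle G (lookup (a ∷ b ∷ c ∷ [])) (distinct-lookup
        ((~⇒≢ ab ∷ ~⇒≢ ac ∷ []) ∷ (~⇒≢ bc ∷ []) ∷ [] ∷ []))
      ((sym ab ∷ sym ac ∷ []) ∷ (sym bc ∷ []) ∷ [] ∷ [])

  forbidden-free : ∀ h → Free G (forbidden h) → Structure.Avoids Fin._≟_ (allFin (order G)) ∈-allFin (edge G) (adj-sym G) (adj-irrefl G) h
  forbidden-free house-c   = house-free
  forbidden-free hammer-c  = hammer-free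
  forbidden-free diamond-c = diamond-free

-- From weights back to clique and chromatic numbers

module Perfection (G : Graph) where

  open Adjacency (edge G) (adj-sym G) (adj-irrefl G)
  open Weights Fin._≟_ (allFin (order G)) ∈-allFin (edge G) (adj-sym G) (adj-irrefl G)
  open Division Fin._≟_ (allFin (order G)) ∈-allFin (Uniqueₚ.allFin⁺ (order G)) (edge G) (adj-sym G) (adj-irrefl G)

  clique⇒HasClique : ∀ {S Q} → Clique Q → All (In S) Q → HasClique G S (length Q)
  clique⇒HasClique {S} {Q} cl Q⊆ = lookup Q , inj , (λ i → ⇒T (All.lookup Q⊆ (∈-lookup i))) , lookup-pairs ~-sym cl
    where
    inj : Injective _≡_ _≡_ (lookup Q)
    inj {i} {j} e with i Fin.≟ j
    ... | yes i≡j = i≡j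
    ... | no i≢j  = ⊥-elim (~⇒≢ (lookup-pairs ~-sym cl i j i≢j) e)

  HasClique⇒clique : ∀ {S k} → HasClique G S k → ∃ λ Q → Clique Q × All (In S) Q × length Q ≡ k
  HasClique⇒clique (f , _ , f∈S , adjacent) = tabulate f , AllPairsₚ.tabulate⁺ (λ {i} {j} → adjacent i j) ,
    Allₚ.tabulate⁺ (λ i → T⇒ (f∈S i)) , length-tabulate f

  one : Fin (order G) → ℕ
  one _ = 1

  wt-constant : ∀ {w k Q} → All (λ v → w v ≡ k) Q → wt w Q ≡ length Q * k
  wt-constant []       = refl
  wt-constant (e ∷ es) = cong₂ _+_ e (wt-constant es)

  wt-one : ∀ {w Q} → All (λ v → w v ≡ 1) Q → wt w Q ≡ length Q
  wt-one {w} {Q} es = trans (wt-constant es) (ℕₚ.*-identityʳ (length Q))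

  all-one : ∀ Q → wt one Q ≡ length Q
  all-one Q = wt-one {one} {Q} (All.tabulate λ _ → refl)

  ω : (Fin (order G) → Bool) → ℕ
  ω S = length (MaxClique.Q (max-clique one S))

  ω-max : ∀ S {Q} → Clique Q → All (In S) Q → length Q ≤ ω S
  ω-max S {Q} cl Q⊆ = ≡-≤-trans (sym (all-one Q))
    (ℕₚ.≤-trans (MaxClique.maximum (max-clique one S) cl Q⊆ (everywhere Q)) (ℕₚ.≤-reflexive (all-one (MaxClique.Q (max-clique one S)))))

  ω-CliqueNumber : ∀ S → CliqueNumber G S (ω S)
  ω-CliqueNumber S = clique⇒HasClique (MaxClique.clique (max-clique one S)) (MaxClique.within (max-clique one S)) ,
    λ j has → let (Q , cl , Q⊆ , e) = HasClique⇒clique has in ≡-≤-trans (sym e) (ω-max S cl Q⊆)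

  clique-colours : ∀ {S k j} → HasClique G S k → Colourable G S j → k ≤ j
  clique-colours {S} (f , _ , f∈S , adjacent) (c , proper) = Finₚ.injective⇒≤ {f = λ i → c (f i) (f∈S i)} inj
    where
    inj : Injective _≡_ _≡_ (λ i → c (f i) (f∈S i))
    inj {i} {j} e with i Fin.≟ j
    ... | yes i≡j = i≡j
    ... | no i≢j  = ⊥-elim (proper (f i) (f j) (f∈S i) (f∈S j) (adjacent i j i≢j) e)

  -- Weight 1 on X and 0 elsewhere restricts the multicolouring to X, and colour number 0 of each
  -- vertex is a proper colouring with ω(X) colours.
  weight-perfect⇒perfect : ∀ {A} → WeightPerfect A → PerfectOn G A
  weight-perfect⇒perfect {A} perf X X⊆A = ω X , ω-CliqueNumber X , ((c , proper′) , λ j → clique-colours (proj₁ (ω-CliqueNumber X)))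
    where
    w : Fin (order G) → ℕ
    w v = if X v then 1 else 0
    w-in : ∀ {v} → In X v → w v ≡ 1
    w-in Xv rewrite Xv = refl
    w-out : ∀ {v} → Out X v → w v ≡ 0
    w-out Xv rewrite Xv = refl
    bound : Bounded A w (ω X)
    bound {Q} cl _ = ≡-≤-trans (trans (wt-split X w Q) (trans (cong₂ _+_
        (wt-one (All.map w-in (inside-In X Q)))
        (trans (wt-constant (All.map w-out (outside-Out X Q))) (ℕₚ.*-zeroʳ (length (outside X Q)))))
        (ℕₚ.+-identityʳ _)))
      (ω-max X (inside-clique X cl) (inside-In X Q))
    open Multicolouring (perf w (ω X) bound)
    0<w : ∀ {v} → T (X v) → 0 < w v
    0<w Xv = ℕₚ.≤-reflexive (sym (w-in (T⇒ Xv)))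
    c : (v : Fin (order G)) → T (X v) → Fin (ω X)
    c v Xv = Fin.fromℕ< (range (T⇒ (X⊆A v Xv)) (0<w Xv))
    proper′ : ∀ u v (Xu : T (X u)) (Xv : T (X v)) → u ~ v → c u Xu ≢ c v Xv
    proper′ u v Xu Xv uv e = proper (T⇒ (X⊆A u Xu)) (T⇒ (X⊆A v Xv)) uv (0<w Xu) (0<w Xv)
      (Finₚ.fromℕ<-injective _ _ (range (T⇒ (X⊆A u Xu)) (0<w Xu)) (range (T⇒ (X⊆A v Xv)) (0<w Xv)) e)

  divisible⇒perfectly-divisible : (∀ S → Divisible S) → PerfectlyDivisible G
  divisible⇒perfectly-divisible div S (v , Sv) = go (ω S) refl
    where
    go : ∀ k → ω S ≡ k → Σ (VSet G) λ A → (Defs._⊆_ {G} A S) × PerfectOn G A ×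
      (∃ λ a → ∃ λ b → CliqueNumber G (Defs._∖_ {G} S A) a × CliqueNumber G S b × a < b)
    go zero e = ⊥-elim (ℕₚ.1+n≰n (subst (1 ≤_) e (ω-max S {v ∷ []} ([] ∷ []) (T⇒ Sv ∷ []))))
    go (suc N) e = Part.A , (λ u Au → ⇒T (Part.A⊆S (T⇒ Au))) , weight-perfect⇒perfect Part.perfect ,
        ω R , ω S , ω-CliqueNumber R , ω-CliqueNumber S , ℕₚ.≤-trans (s≤s light) (ℕₚ.≤-reflexive (sym e))
      where
      module Part = Splits (div S one (λ _ → s≤s z≤n) N λ {Q} cl Q⊆ →
        ≡-≤-trans (all-one Q) (ℕₚ.≤-trans (ω-max S cl Q⊆) (ℕₚ.≤-reflexive e)))
      R : VSet G
      R = Defs._∖_ {G} S Part.A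
      light : ω R ≤ N
      light = ≡-≤-trans (sym (all-one (MaxClique.Q (max-clique one R)))) (Part.light (MaxClique.clique (max-clique one R))
        (All.map (λ {u} h → proj₁ (∧-elim (S u) h)) (MaxClique.within (max-clique one R)))
        (All.map (λ {u} h → not-true (proj₂ (∧-elim (S u) h))) (MaxClique.within (max-clique one R))))

-- Triangle-free graphs

module TriangleFree (G : Graph) (S : VSet G) where

  open Adjacency (edge G) (adj-sym G) (adj-irrefl G)
  open Weights Fin._≟_ (allFin (order G)) ∈-allFin (edge G) (adj-sym G) (adj-irrefl G)
  open Division Fin._≟_ (allFin (order G)) ∈-allFin (Uniqueₚ.allFin⁺ (order G)) (edge G) (adj-sym G) (adj-irrefl G)
  open Induction G using (TriangleIn)

  S? : ∀ v → Dec (In S v)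
  S? v = S v Bool.≟ true

  members : List (Fin (order G))
  members = filter S? (allFin (order G))

  induced : Graph
  induced = record
    { n = length members
    ; adj = λ i j → edge G (lookup members i) (lookup members j)
    ; adj-sym = λ i j → adj-sym G (lookup members i) (lookup members j)
    ; adj-irrefl = λ i → adj-irrefl G (lookup members i) }

  induced-embeds : Embedding induced G
  induced-embeds = lookup members , Patterns.distinct-lookup G (Uniqueₚ.filter⁺ S? (Uniqueₚ.allFin⁺ (order G))) , λ _ _ → refl

  module I = Adjacency (edge induced) (adj-sym induced) (adj-irrefl induced)

  induced-triangle-free : ¬ TriangleIn S → Free induced triangle
  induced-triangle-free none (f , _ , agree) = none (g zero , g (suc zero) , g (suc (suc zero)) ,
      member _ , member _ , member _ , sym (agree zero (suc zero)) , sym (agree zero (suc (suc zero))) , sym (agree (suc zero) (suc (suc zero))))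
    where
    g : Fin 3 → Fin (order G)
    g i = lookup members (f i)
    member : ∀ i → In S (lookup members i)
    member i = All.lookup (Allₚ.all-filter S? (allFin (order G))) (∈-lookup i)

  locate : ∀ {v} → In S v → v ∈ members
  locate {v} Sv = ∈-filter⁺ S? (∈-allFin v) Sv

  small-cliques : Free induced triangle → ∀ R {k} → HasClique induced R k → k ≤ 2
  small-cliques free R {k} (f , _ , _ , adjacent) = ℕₚ.≮⇒≥ λ 2<k →
    let at : ∀ i → i < 3 → Fin k
        at i i<3 = Fin.fromℕ< (ℕₚ.<-≤-trans i<3 2<k)
        adjacent-at : ∀ i j (p : i < 3) (q : j < 3) → i ≢ j → f (at i p) I.~ f (at j q)
        adjacent-at i j p q i≢j = adjacent _ _ λ e → i≢j (Finₚ.fromℕ<-injective i j _ _ e)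
        p₀ = s≤s z≤n
        p₁ = s≤s (s≤s z≤n)
        p₂ = s≤s (s≤s (s≤s z≤n))
    in free (Patterns.triangle-embeds induced
         (adjacent-at 0 1 p₀ p₁ (λ ()) , adjacent-at 0 2 p₀ p₂ (λ ()) , adjacent-at 1 2 p₁ p₂ (λ ())))

  -- A perfect division of a triangle-free graph consists of a 2-colourable part and a stable part.
  module FromDivision (free : Free induced triangle) (A : VSet induced) (perfect : PerfectOn induced A)
    {a b : ℕ} (ωB : CliqueNumber induced (Defs._∖_ {induced} (λ _ → true) A) a)
    (ωS : CliqueNumber induced (λ _ → true) b) (a<b : a < b) where

    -- The clique number of the second part is below a number that is at most 2.
    B-stable : ∀ {i j} → i I.~ j → A i ≡ false → A j ≡ false → ⊥
    B-stable {i} {j} ij Ai Aj = ℕₚ.1+n≰n (ℕₚ.≤-trans (proj₂ ωB 2 has) (ℕₚ.≤-pred (ℕₚ.≤-trans a<b (small-cliques free (λ _ → true) (proj₁ ωS)))))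
      where
      has : HasClique induced (Defs._∖_ {induced} (λ _ → true) A) 2
      has = Perfection.clique⇒HasClique induced ((ij ∷ []) ∷ [] ∷ []) (cong not Ai ∷ cong not Aj ∷ [])

    chosen : ∃ λ k → CliqueNumber induced A k × ChromaticNumber induced A k
    chosen = perfect A (λ _ h → h)

    colour : ∀ i → A i ≡ true → Fin (proj₁ chosen)
    colour i Ai = proj₁ (proj₁ (proj₂ (proj₂ chosen))) i (⇒T Ai)

    is-zero : ∀ {k} → Fin k → Bool
    is-zero zero    = true
    is-zero (suc _) = false

    is-zero-injective : ∀ {k} → k ≤ 2 → (x y : Fin k) → is-zero x ≡ is-zero y → x ≡ y
    is-zero-injective _ zero zero _ = refl
    is-zero-injective _ (suc zero) (suc zero) _ = refl
    is-zero-injective (s≤s (s≤s z≤n)) (suc zero) (suc (suc ())) _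
    is-zero-injective (s≤s (s≤s z≤n)) (suc (suc ())) (suc _) _

    side-by : ∀ i b → A i ≡ b → Bool
    side-by i true  Ai = is-zero (colour i Ai)
    side-by i false _  = false

    sideᵢ : Fin (length members) → Bool
    sideᵢ i = side-by i (A i) refl

    side-colour : ∀ i b (e : A i ≡ b) → b ≡ true → ∃ λ Ai → side-by i b e ≡ is-zero (colour i Ai)
    side-colour i true e _ = e , refl

    sides-differ : ∀ {i j} → i I.~ j → A i ≡ true → A j ≡ true → sideᵢ i ≢ sideᵢ j
    sides-differ {i} {j} ij Ai Aj e with side-colour i (A i) refl Ai | side-colour j (A j) refl Aj
    ... | Ai′ , eᵢ | Aj′ , eⱼ = proj₂ (proj₁ (proj₂ (proj₂ chosen))) i j (⇒T Ai′) (⇒T Aj′) ij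
      (is-zero-injective (small-cliques free A (proj₁ (proj₁ (proj₂ chosen)))) _ _ (trans (sym eᵢ) (trans e eⱼ)))

    lookup-∈ : ∀ {u} (p : u ∈ members) → lookup members (Any.index p) ≡ u
    lookup-∈ p = sym (lookup-index p)

    located : (Fin (length members) → Bool) → Fin (order G) → Bool
    located f v with S? v
    ... | yes Sv = f (Any.index (locate Sv))
    ... | no _   = false

    located-≡ : ∀ {v} → In S v → ∃ λ i → lookup members i ≡ v × (∀ f → located f v ≡ f i)
    located-≡ {v} Sv with S? v
    ... | yes Sv′ = Any.index (locate Sv′) , lookup-∈ (locate Sv′) , λ _ → refl
    ... | no ¬Sv  = ⊥-elim (¬Sv Sv)

    division-divisible : Divisible S
    division-divisible = tripartite-divisible (located (not ∘ A)) (located sideᵢ)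
      (λ Su Sv uv → stable (located-≡ Su) (located-≡ Sv) uv)
      (λ Su Sv uv → alternate (located-≡ Su) (located-≡ Sv) uv)
      where
      Located : Fin (order G) → Set
      Located v = ∃ λ i → lookup members i ≡ v × (∀ f → located f v ≡ f i)
      stable : ∀ {u v} → Located u → Located v → u ~ v → In (located (not ∘ A)) u → In (located (not ∘ A)) v → ⊥
      stable (i , refl , fi) (j , refl , fj) uv tu tv =
        B-stable uv (not-true (trans (sym (fi (not ∘ A))) tu)) (not-true (trans (sym (fj (not ∘ A))) tv))
      alternate : ∀ {u v} → Located u → Located v → u ~ v → Out (located (not ∘ A)) u → Out (located (not ∘ A)) v →
        located sideᵢ u ≢ located sideᵢ v
      alternate (i , refl , fi) (j , refl , fj) uv tu tv e =
        sides-differ uv (not-false (trans (sym (fi (not ∘ A))) tu)) (not-false (trans (sym (fj (not ∘ A))) tv))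
          (trans (sym (fi sideᵢ)) (trans e (fj sideᵢ)))

  triangle-free-divisible : (Free induced triangle → PerfectlyDivisible induced) → ¬ TriangleIn S → Divisible S
  triangle-free-divisible pd none with Finₚ.any? S?
  -- Perfect divisibility speaks only of nonempty sets, so the empty case is treated separately.
  ... | yes (v , Sv) =
    let free = induced-triangle-free none
        (A , _ , perfect , a , b , ωB , ωS , a<b) = pd free (λ _ → true) (Any.index (locate Sv) , tt)
    in FromDivision.division-divisible free A perfect ωB ωS a<b
  ... | no empty = tripartite-divisible (λ _ → false) (λ _ → false)
    (λ {u} Su _ _ _ _ → empty (u , Su)) (λ {u} Su _ _ _ _ → ⊥-elim (empty (u , Su)))

-- The equivalence

embedding-trans : ∀ {F K G} → Embedding F K → Embedding K G → Embedding F G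
embedding-trans (f , f-inj , f-adj) (g , g-inj , g-adj) =
  g ∘ f , f-inj ∘ g-inj , λ i j → trans (f-adj i j) (g-adj (f i) (f j))

triangle∈bull : Embedding triangle bull
triangle∈bull = Patterns.triangle-embeds bull {zero} {suc zero} {suc (suc zero)} (refl , refl , refl)

triangle∈forbidden : ∀ h → Embedding triangle (forbidden h)
triangle∈forbidden house-c   = Patterns.triangle-embeds house {zero} {suc (suc zero)} {suc (suc (suc (suc zero)))} (refl , refl , refl)
triangle∈forbidden hammer-c  = Patterns.triangle-embeds hammer {zero} {suc zero} {suc (suc zero)} (refl , refl , refl)
triangle∈forbidden diamond-c = Patterns.triangle-embeds diamond {zero} {suc zero} {suc (suc zero)} (refl , refl , refl)

theorem6 : (h : Choice) (𝒢 : Graph → Set) → Hereditary 𝒢 →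
    ((∀ (G : Graph) → 𝒢 G → Free G bull → Free G (forbidden h) → PerfectlyDivisible G)
    ⇔ (∀ (G : Graph) → 𝒢 G → Free G triangle → PerfectlyDivisible G))
theorem6 h 𝒢 hereditary = mk⇔
  (λ pd G G∈𝒢 free → pd G G∈𝒢
    (λ e → free (embedding-trans {triangle} {bull} {G} triangle∈bull e))
    (λ e → free (embedding-trans {triangle} {forbidden h} {G} (triangle∈forbidden h) e)))
  (λ pd G G∈𝒢 bull-free h-free → Perfection.divisible⇒perfectly-divisible G
    (Induction.divisible G h (Patterns.bull-free G bull-free) (Patterns.forbidden-free G h h-free)
      λ S → TriangleFree.triangle-free-divisible G S
        (pd (TriangleFree.induced G S) (hereditary (TriangleFree.induced-embeds G S) G∈𝒢))))
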